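{- Let $q$ be a prime power, $e\ge 2$ an integer, $V$ a $(2e+1)$-dimensional vector space over $\mathrm{GF}(q)$, $H$ a hyperplane of $V$, and $\sigma$ a polarity of $H$. Let $([V],\mathcal{A}'\cup\mathcal{B}')$ be the design defined from $V,H,\sigma$ in the context, and let $\tilde{J}_q(2e+1,e)$ be the twisted Grassmann graph defined from $V,H$ in the context. Then $\tilde{J}_q(2e+1,e)$ is isomorphic to the block graph of the design $([V],\mathcal{A}'\cup\mathcal{B}')$, that is, the graph whose vertices are the blocks in $\mathcal{A}'\cup\mathcal{B}'$, where two blocks are adjacent if and only if their intersection has size $(q^e-1)/(q-1)$.
   Context: Let $q$ be a prime power, $e\ge 2$ an integer, $V$ a $(2e+1)$-dimensional vector space over $\mathrm{GF}(q)$, and $H$ a fixed hyperplane of $V$ (a linear subspace of dimension $2e$). Notation. If $W\subseteq V$ is a subset closed under multiplication by elements of $\mathrm{GF}(q)$, then $[W]$ denotes the set of $1$-dimensional subspaces of $V$ contained in $W$. For a vector space $W$, $\genfrac{[}{]}{0pt}{}{W}{k}$ denotes the set of $k$-dimensional subspaces of $W$. Twisted Grassmann graph. The graph $\tilde{J}_q(2e+1,e)$ has vertex set $\mathcal{A}\cup\mathcal{B}$, where $$\mathcal{A}=\left\{W\in\genfrac{[}{]}{0pt}{}{V}{e+1}\;\middle|\; W\not\subset H\right\},\qquad \mathcal{B}=\genfrac{[}{]}{0pt}{}{H}{e-1},$$ with (symmetric) adjacency defined by: for $W_1,W_2\in\mathcal{A}$, $W_1\sim W_2$ iff $\dim (W_1\cap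 W_2)=e$; for $W_1\in\mathcal{A}$, $W_2\in\mathcal{B}$, $W_1\sim W_2$ iff $W_1\supset W_2$; for $W_1,W_2\in\mathcal{B}$, $W_1\sim W_2$ iff $\dim (W_1\cap W_2)=e-2$. Polarity. A polarity $\sigma$ of $H$ is an inclusion-reversing permutation of the set of all linear subspaces of $H$ such that $\sigma^2$ is the identity. The design. The incidence structure $([V],\mathcal{A}'\cup\mathcal{B}')$ has point set $[V]$ and block set $\mathcal{A}'\cup\mathcal{B}'$ (blocks are subsets of $[V]$), where $$\mathcal{A}'=\{[\sigma(W\cap H)\cup(W\setminus H)]\mid W\in\mathcal{A}\},\qquad \mathcal{B}'=\left\{[W]\;\middle|\; W\in\genfrac{[}{]}{0pt}{}{H}{e+1}\right\}.$$ -}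

module Defs where

open import Algebra.Apartness.Bundles using (HeytingField; HeytingCommutativeRing)
open import Algebra.Bundles using (CommutativeRing)
open import Algebra.Module.Bundles using (Module)
import Algebra.Properties.CommutativeMonoid.Sum as Sum
open import Data.Fin.Base using (Fin)
open import Data.Nat.Base as ℕ using (ℕ; suc; _^_; _∸_; NonZero)
import Data.Nat.Properties as ℕₚ
open import Data.Nat.Primality using (Prime; prime⇒nonTrivial)
open import Data.Product.Base using (Σ; Σ-syntax; ∃-syntax; _×_; _,_; proj₁; proj₂)
open import Data.Sum.Base using (inj₁; inj₂)
open import Data.Vec.Functional using (Vector)
open import Function.Bundles using (Inverse; _⇔_)
open import Level using (Level; Lift; _⊔_) renaming (suc to lsuc)
open import Relation.Binary.Bundles using (Setoid)
open import Relation.Binary.Core using (Rel)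
import Relation.Binary.Construct.On as On
open import Relation.Binary.PropositionalEquality as ≡ using (_≡_)
open import Relation.Nullary.Decidable using (_×-dec_)
open import Relation.Unary
  using (Pred; U; Decidable; _∈_; _⊆_; _⊈_; _≐_; _∩_; _∪_; _∖_)
open import Relation.Unary.Relation.Binary.Equality using (≐-setoid)

HasSize : ∀ {a ℓ} → Setoid a ℓ → ℕ → Set (a ⊔ ℓ)
HasSize S n = Inverse S (≡.setoid (Fin n))

subsetoid : ∀ {a ℓ p} (S : Setoid a ℓ) → Pred (Setoid.Carrier S) p → Setoid (a ⊔ p) ℓ
subsetoid S P = On.setoid S (proj₁ {B = P})

IsPrimePower : ℕ → Set
IsPrimePower q = ∃[ p ] ∃[ k ] Prime p × q ≡ p ^ suc k

primePower⇒q∸1-nonZero : ∀ {q} → IsPrimePower q → NonZero (q ∸ 1)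
primePower⇒q∸1-nonZero (p , k , p-prime , ≡.refl) =
  ℕ.>-nonZero (ℕₚ.m<n⇒0<n∸m (ℕₚ.<-≤-trans (ℕ.nonTrivial⇒n>1 p) p≤p^[1+k]))
  where
  instance
    p-nonTrivial = prime⇒nonTrivial p-prime
    p-nonZero    = ℕ.nonTrivial⇒nonZero p
  p≤p^[1+k] : p ℕ.≤ p ^ suc k
  p≤p^[1+k] = ℕₚ.m≤m*n p (p ^ k) {{ℕₚ.m^n≢0 p k}}

record Graph v ℓ a : Set (lsuc (v ⊔ ℓ ⊔ a)) where
  infix 4 _~_
  field
    vertices : Setoid v ℓ
    _~_      : Rel (Setoid.Carrier vertices) a

infix 4 _≅_

record _≅_ {v₁ ℓ₁ a₁ v₂ ℓ₂ a₂} (G₁ : Graph v₁ ℓ₁ a₁) (G₂ : Graph v₂ ℓ₂ a₂)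
  : Set (v₁ ⊔ ℓ₁ ⊔ a₁ ⊔ v₂ ⊔ ℓ₂ ⊔ a₂) where
  private
    module G₁ = Graph G₁
    module G₂ = Graph G₂
  field
    bijection : Inverse G₁.vertices G₂.vertices
  open Inverse bijection using (to)
  field
    adjacency : ∀ x y → x G₁.~ y ⇔ to x G₂.~ to y

record IncidenceStructure a ℓ p b : Set (lsuc (a ⊔ ℓ ⊔ p ⊔ b)) where
  field
    points : Setoid a ℓ
    Blocks : Pred (Pred (Setoid.Carrier points) p) b

blockGraph : ∀ {a ℓ p b} → IncidenceStructure a ℓ p b → ℕ →
             Graph (a ⊔ lsuc p ⊔ b) (a ⊔ p) (a ⊔ ℓ ⊔ p)
blockGraph {p = p} D n = record
  { vertices = On.setoid (≐-setoid (Setoid.Carrier points) p) (proj₁ {B = Blocks})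
  ; _~_      = λ (B₁ , _) (B₂ , _) → HasSize (subsetoid points (B₁ ∩ B₂)) n
  }
  where open IncidenceStructure D

-- Tightness makes apartness from 0 the classical x ≉ 0 when the field is
-- finite, so a finite Heyting field is a finite field in the usual sense.
scalars : ∀ {c ℓ₁ ℓ₂} → HeytingField c ℓ₁ ℓ₂ → CommutativeRing c ℓ₁
scalars F = HeytingCommutativeRing.commutativeRing (HeytingField.heytingCommutativeRing F)

module VectorSpace {c ℓ₁ ℓ₂ m ℓm}
  (F : HeytingField c ℓ₁ ℓ₂) (V : Module (scalars F) m ℓm) where

  open HeytingField F using (Carrier; _≈_; 0#)
  open Module V
  open Sum +ᴹ-commutativeMonoid using (sum)

  -- Large enough for the span of a family of vectors to be a subset.
  sl : Level
  sl = c ⊔ m ⊔ ℓm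

  combination : ∀ {k} → Vector Carrier k → Vector Carrierᴹ k → Carrierᴹ
  combination a v = sum (λ i → a i *ₗ v i)

  LinearlyIndependent : ∀ {k} → Vector Carrierᴹ k → Set (c ⊔ ℓ₁ ⊔ ℓm)
  LinearlyIndependent v = ∀ a → combination a v ≈ᴹ 0ᴹ → ∀ i → a i ≈ 0#

  Span : ∀ {k} → Vector Carrierᴹ k → Pred Carrierᴹ (c ⊔ ℓm)
  Span v x = ∃[ a ] x ≈ᴹ combination a v

  HasDim : ∀ {p} → Pred Carrierᴹ p → ℕ → Set (c ⊔ ℓ₁ ⊔ m ⊔ ℓm ⊔ p)
  HasDim W k = Σ[ v ∈ Vector Carrierᴹ k ] LinearlyIndependent v × W ≐ Span v

  -- Membership is required to be decidable because, over a finite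
  -- field, the classical subsets of V are exactly the decidable ones.
  record Subspace : Set (c ⊔ lsuc sl) where
    field
      members   : Pred Carrierᴹ sl
      decidable : Decidable members
      respects  : ∀ {x y} → x ≈ᴹ y → x ∈ members → y ∈ members
      0∈        : 0ᴹ ∈ members
      +-closed  : ∀ {x y} → x ∈ members → y ∈ members → x +ᴹ y ∈ members
      *ₗ-closed : ∀ a {x} → x ∈ members → a *ₗ x ∈ members

  open Subspace public using () renaming (members to ⟪_⟫)

  subspaces : Setoid (lsuc sl) sl
  subspaces = On.setoid (≐-setoid Carrierᴹ sl) ⟪_⟫

  infixr 7 _⊓_

  _⊓_ : Subspace → Subspace → Subspace
  W₁ ⊓ W₂ = record
    { members   = ⟪ W₁ ⟫ ∩ ⟪ W₂ ⟫
    ; decidable = λ x → decidable W₁ x ×-dec decidable W₂ x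
    ; respects  = λ x≈y (p , q) → respects W₁ x≈y p , respects W₂ x≈y q
    ; 0∈        = 0∈ W₁ , 0∈ W₂
    ; +-closed  = λ (p , q) (p′ , q′) → +-closed W₁ p p′ , +-closed W₂ q q′
    ; *ₗ-closed = λ a (p , q) → *ₗ-closed W₁ a p , *ₗ-closed W₂ a q
    }
    where
    open Subspace

  Grassmannian : ∀ {p} → Pred Carrierᴹ p → ℕ → Pred Subspace _
  Grassmannian S k W = ⟪ W ⟫ ⊆ S × HasDim ⟪ W ⟫ k

  SubspaceOf : Subspace → Set (lsuc sl)
  SubspaceOf H = Σ[ W ∈ Subspace ] ⟪ W ⟫ ⊆ ⟪ H ⟫

  subspacesOf : Subspace → Setoid (lsuc sl) sl
  subspacesOf H = subsetoid subspaces (λ W → ⟪ W ⟫ ⊆ ⟪ H ⟫)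

  record Polarity (H : Subspace) : Set (lsuc sl) where
    field
      permutation : Inverse (subspacesOf H) (subspacesOf H)

    apply : SubspaceOf H → Subspace
    apply W = proj₁ (Inverse.to permutation W)

    field
      reversing  : ∀ (W₁ W₂ : SubspaceOf H) →
                   ⟪ proj₁ W₁ ⟫ ⊆ ⟪ proj₁ W₂ ⟫ → ⟪ apply W₂ ⟫ ⊆ ⟪ apply W₁ ⟫
      involutive : ∀ (W : SubspaceOf H) →
                   ⟪ apply (Inverse.to permutation W) ⟫ ≐ ⟪ proj₁ W ⟫

  points : Setoid _ sl
  points = subsetoid subspaces (Grassmannian U 1)

  Point : Set _
  Point = Setoid.Carrier points

  [_] : Pred Carrierᴹ sl → Pred Point sl
  [ S ] (L , _) = ⟪ L ⟫ ⊆ S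

  module _ (H : Subspace) (e : ℕ) where

    -- _⊈_ is the negation of inclusion; the library's _⊄_ negates proper
    -- inclusion only.
    𝒜 : Pred Subspace _
    𝒜 W = W ∈ Grassmannian U (e ℕ.+ 1) × ⟪ W ⟫ ⊈ ⟪ H ⟫

    ℬ : Pred Subspace _
    ℬ = Grassmannian ⟪ H ⟫ (e ∸ 1)

    -- 𝒜 and ℬ are disjoint, so adjacency does not depend on the proof that
    -- a subspace belongs to their union.
    twistedGrassmannGraph : Graph _ _ _
    twistedGrassmannGraph = record
      { vertices = subsetoid subspaces (𝒜 ∪ ℬ)
      ; _~_      = adjacent
      }
      where
      adjacent : Rel (Σ Subspace (𝒜 ∪ ℬ)) (sl ⊔ ℓ₁)
      adjacent (W₁ , inj₁ _) (W₂ , inj₁ _) = HasDim (⟪ W₁ ⟫ ∩ ⟪ W₂ ⟫) e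
      adjacent (W₁ , inj₁ _) (W₂ , inj₂ _) = Lift (sl ⊔ ℓ₁) (⟪ W₂ ⟫ ⊆ ⟪ W₁ ⟫)
      adjacent (W₁ , inj₂ _) (W₂ , inj₁ _) = Lift (sl ⊔ ℓ₁) (⟪ W₁ ⟫ ⊆ ⟪ W₂ ⟫)
      adjacent (W₁ , inj₂ _) (W₂ , inj₂ _) = HasDim (⟪ W₁ ⟫ ∩ ⟪ W₂ ⟫) (e ∸ 2)

    module _ (σ : Polarity H) where

      𝒜′ : Pred (Pred Point sl) _
      𝒜′ B = ∃[ W ] W ∈ 𝒜 ×
        B ≐ [ ⟪ Polarity.apply σ (W ⊓ H , proj₂) ⟫ ∪ (⟪ W ⟫ ∖ ⟪ H ⟫) ]

      ℬ′ : Pred (Pred Point sl) _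
      ℬ′ B = ∃[ W ] W ∈ Grassmannian ⟪ H ⟫ (e ℕ.+ 1) × B ≐ [ ⟪ W ⟫ ]

      design : IncidenceStructure _ _ _ _
      design = record
        { points = points
        ; Blocks = 𝒜′ ∪ ℬ′
        }

{-# OPTIONS --safe #-}
module Submission where

-- The isomorphism sends W ∈ 𝒜 to the block [σ(W ∩ H) ∪ (W ∖ H)] and W ∈ ℬ to
-- [σ(W)].  A polarity reverses strict chains, so dim σ(W) = 2e − dim W, and it
-- turns joins into meets; with the modular law,
-- dim (σ(A) ∩ σ(B)) = 2e − dim A − dim B + dim (A ∩ B).
-- For W₁, W₂ ∈ 𝒜 with traces Uᵢ = Wᵢ ∩ H this gives
-- dim (σ(U₁) ∩ σ(U₂)) = dim (U₁ ∩ U₂), so that replacing Uᵢ by σ(Uᵢ) does not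
-- change the number of points in the intersection: it is that of W₁ ∩ W₂.  The
-- other two cases compare with subspaces of H only.
-- Dimensions are compared through cardinalities: a subspace with a basis of k
-- vectors has q ^ k elements.

open import Defs
open import Algebra.Apartness.Bundles using (HeytingField)
open import Algebra.Bundles using (AbelianGroup; CommutativeRing)
open import Algebra.Module.Bundles using (Module)
import Algebra.Properties.AbelianGroup as AbelianGroupProperties
import Algebra.Properties.CommutativeMonoid.Sum as Sum
import Algebra.Properties.CommutativeSemigroup as CommutativeSemigroupProperties
open import Data.Empty using (⊥-elim)
open import Data.Fin.Base using (Fin; zero; suc; combine; finToFun; funToFin; splitAt; join)
open import Data.Fin.Properties as Finₚ
  using (any?; finToFun-funToFin; funToFin-finToFin; injective⇒≤; join-splitAt; splitAt-join)
open import Data.Nat.Base using (ℕ; zero; suc; _+_; _*_; _∸_; _^_; _/_; _≤_; _<_; z≤n; s≤s;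
  NonZero; >-nonZero; ≢-nonZero⁻¹)
open import Data.Nat.DivMod using (m*n/n≡m)
import Data.Nat.Properties as ℕₚ
import Data.Nat.Tactic.RingSolver as ℕ-solver
open import Data.Product.Base using (Σ; ∃; ∃-syntax; _×_; _,_; proj₁; proj₂)
open import Data.Sum.Base using (_⊎_; inj₁; inj₂)
open import Data.Unit.Base using (tt)
open import Data.Vec.Functional using (Vector; _∷_)
open import Function.Base using (_∘_; id; case_of_)
open import Function.Bundles using (Equivalence; Inverse; _⇔_; mk⇔)
import Function.Construct.Symmetry as Symmetry
open import Function.Properties.Bijection using (Bijection⇒Inverse)
open import Level using (Level; Lift; lift; lower; _⊔_) renaming (suc to lsuc)
open import Relation.Binary.Bundles using (Setoid)
open import Relation.Binary.Core using (Rel)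
open import Relation.Binary.PropositionalEquality as ≡ using (_≡_; refl; cong; cong₂; subst)
import Relation.Binary.Reasoning.Setoid as ≈-Reasoning
open import Relation.Nullary.Decidable using (Dec; yes; no; ¬?; _×-dec_; map′; decidable-stable)
open import Relation.Nullary.Negation using (¬_; contradiction)
open import Relation.Unary using (Pred; Decidable; U; _∈_; _∉_; _⊆_; _⊈_; _≐_; _∩_; _∪_; _∖_)
open import Relation.Unary.Properties using (≐-refl; ≐-sym; ≐-trans)

-- Finite setoids and their sizes

module _ {a ℓ} {S : Setoid a ℓ} where
  private module S = Setoid S

  enumeration⇒size : ∀ {n} (enum : Fin n → S.Carrier) →
    (∀ i j → enum i S.≈ enum j → i ≡ j) → (∀ x → ∃[ i ] enum i S.≈ x) → HasSize S n
  enumeration⇒size enum injective surjective = Symmetry.inverse (Bijection⇒Inverse record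
    { to        = enum
    ; cong      = λ { refl → S.refl }
    ; bijective = (λ {i} {j} → injective i j)
                , (λ x → proj₁ (surjective x) , λ { refl → proj₂ (surjective x) })
    })

  module Size {n} (size : HasSize S n) where
    open Inverse size public using (to; from; to-cong)

    from-to : ∀ x → from (to x) S.≈ x
    from-to = Inverse.strictlyInverseʳ size

    to-from : ∀ i → to (from i) ≡ i
    to-from = Inverse.strictlyInverseˡ size

    to-injective : ∀ {x y} → to x ≡ to y → x S.≈ y
    to-injective {x} {y} eq = S.trans (S.sym (from-to x))
      (S.trans (Inverse.from-cong size eq) (from-to y))

    from-injective : ∀ i j → from i S.≈ from j → i ≡ j
    from-injective i j eq = ≡.trans (≡.sym (to-from i)) (≡.trans (to-cong eq) (to-from j))

    ≈-dec : ∀ x y → Dec (x S.≈ y)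
    ≈-dec x y = map′ to-injective to-cong (to x Finₚ.≟ to y)

    -- Testing the n representatives `from i` suffices because P respects the equality of S.
    search : ∀ {p} {P : Pred S.Carrier p} → Decidable P →
             (∀ {x y} → x S.≈ y → P x → P y) → Dec (∃ P)
    search P? resp = map′ (λ (i , p) → from i , p) (λ (x , p) → to x , resp (S.sym (from-to x)) p)
      (any? (P? ∘ from))

  -- Serves to list the points inside a hyperplane and those outside it separately.
  ⊎-enumeration⇒size : ∀ {m n} (enum : Fin m ⊎ Fin n → S.Carrier) →
    (∀ i j → enum i S.≈ enum j → i ≡ j) → (∀ x → ∃[ i ] enum i S.≈ x) → HasSize S (m + n)
  ⊎-enumeration⇒size {m} {n} enum injective surjective = enumeration⇒size (enum ∘ splitAt m)
    (λ i j eq → ≡.trans (≡.sym (join-splitAt m n i))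
                  (≡.trans (cong (join m n) (injective _ _ eq)) (join-splitAt m n j)))
    (λ x → let i , eq = surjective x in
      join m n i , S.trans (S.reflexive (cong enum (splitAt-join m n i))) eq)

-- Composed with the two enumerations, f becomes an injection of `Fin m` into `Fin n`.
size-mono : ∀ {a b ℓ ℓ′} {S : Setoid a ℓ} {T : Setoid b ℓ′} {m n} → HasSize S m → HasSize T n →
  (f : Setoid.Carrier S → Setoid.Carrier T) →
  (∀ {x y} → Setoid._≈_ T (f x) (f y) → Setoid._≈_ S x y) → m ≤ n
size-mono S-size T-size f reflects =
  injective⇒≤ {f = T.to ∘ f ∘ S.from} (λ eq → S.from-injective _ _ (reflects (T.to-injective eq)))
  where
  module S = Size S-size
  module T = Size T-size

size-unique : ∀ {a ℓ} {S : Setoid a ℓ} {m n} → HasSize S m → HasSize S n → m ≡ n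
size-unique m-size n-size =
  ℕₚ.≤-antisym (size-mono m-size n-size id id) (size-mono n-size m-size id id)

subsetoid-size-resp : ∀ {a ℓ p r n} (S : Setoid a ℓ)
  {P : Pred (Setoid.Carrier S) p} {R : Pred (Setoid.Carrier S) r} →
  P ≐ R → HasSize (subsetoid S P) n → HasSize (subsetoid S R) n
subsetoid-size-resp S (P⊆R , R⊆P) size = enumeration⇒size
  (λ i → let x , x∈P = P.from i in x , P⊆R x∈P)
  P.from-injective
  (λ (x , x∈R) → P.to (x , R⊆P x∈R) , P.from-to (x , R⊆P x∈R))
  where module P = Size size

funToFin-cong : ∀ {k n} {f g : Fin k → Fin n} → (∀ i → f i ≡ g i) → funToFin f ≡ funToFin g
funToFin-cong {zero}  eq = refl
funToFin-cong {suc k} eq = cong₂ combine (eq zero) (funToFin-cong (eq ∘ suc))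

-- The number of points of a projective space

module _ (q : ℕ) where

  -- The sum 1 + q + ... + q ^ (k - 1). The recursion mirrors the count along a chain of subspaces:
  -- going from dimension k to k + 1 adds q ^ k points.
  pointCount : ℕ → ℕ
  pointCount zero    = 0
  pointCount (suc k) = pointCount k + q ^ k

module _ {q : ℕ} (1<q : 1 < q) where

  private instance
    q-nonZero : NonZero q
    q-nonZero = >-nonZero (ℕₚ.<-trans (s≤s z≤n) 1<q)

  ^-cancel-≤ : ∀ {a b} → q ^ a ≤ q ^ b → a ≤ b
  ^-cancel-≤ q^a≤q^b = ℕₚ.≮⇒≥ λ b<a → ℕₚ.<⇒≱ (ℕₚ.^-monoʳ-< q 1<q b<a) q^a≤q^b

  pointCount-mono-≤ : ∀ {a b} → a ≤ b → pointCount q a ≤ pointCount q b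
  pointCount-mono-≤ {b = zero}  z≤n = z≤n
  pointCount-mono-≤ {b = suc b} a≤1+b with ℕₚ.m≤n⇒m<n∨m≡n a≤1+b
  ... | inj₁ (s≤s a≤b) = ℕₚ.≤-trans (pointCount-mono-≤ a≤b) (ℕₚ.m≤m+n _ _)
  ... | inj₂ refl      = ℕₚ.≤-refl

  pointCount-mono-< : ∀ {a b} → a < b → pointCount q a < pointCount q b
  pointCount-mono-< {a} a<b = ℕₚ.<-≤-trans
    (ℕₚ.m<m+n (pointCount q a) (ℕₚ.m^n>0 q a)) (pointCount-mono-≤ a<b)

  -- Makes a dimension recoverable from a number of points.
  pointCount-injective : ∀ {a b} → pointCount q a ≡ pointCount q b → a ≡ b
  pointCount-injective {a} {b} eq = ℕₚ.≤-antisym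
    (ℕₚ.≮⇒≥ λ b<a → ℕₚ.<⇒≢ (pointCount-mono-< b<a) (≡.sym eq))
    (ℕₚ.≮⇒≥ λ a<b → ℕₚ.<⇒≢ (pointCount-mono-< a<b) eq)

  -- The geometric series, cleared of its denominator so that induction goes through.
  pointCount-geometric : ∀ k → 1 + pointCount q k * (q ∸ 1) ≡ q ^ k
  pointCount-geometric zero    = refl
  pointCount-geometric (suc k) = begin
    1 + (pointCount q k + q ^ k) * (q ∸ 1)           ≡⟨ regroup (pointCount q k) (q ^ k) (q ∸ 1) ⟩
    (1 + pointCount q k * (q ∸ 1)) + q ^ k * (q ∸ 1) ≡⟨ cong (_+ q ^ k * (q ∸ 1)) (pointCount-geometric k) ⟩
    q ^ k + q ^ k * (q ∸ 1)                          ≡⟨ ℕₚ.*-suc (q ^ k) (q ∸ 1) ⟨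
    q ^ k * suc (q ∸ 1)                              ≡⟨ cong (q ^ k *_) (ℕₚ.suc-pred q) ⟩
    q ^ k * q                                        ≡⟨ ℕₚ.*-comm (q ^ k) q ⟩
    q * q ^ k                                        ∎
    where
    open ≡.≡-Reasoning
    regroup : ∀ g p r → 1 + (g + p) * r ≡ (1 + g * r) + p * r
    regroup = ℕ-solver.solve-∀

  pointCount-quotient : ∀ k → .{{_ : NonZero (q ∸ 1)}} → (q ^ k ∸ 1) / (q ∸ 1) ≡ pointCount q k
  pointCount-quotient k = ≡.trans
    (cong (λ n → (n ∸ 1) / (q ∸ 1)) (≡.sym (pointCount-geometric k)))
    (m*n/n≡m (pointCount q k) (q ∸ 1))

-- Scalars of a finite Heyting field

module FiniteVectorSpace {c ℓ₁ ℓ₂ m ℓm : Level} {q : ℕ} (1<q : 1 < q)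
  (F : HeytingField c ℓ₁ ℓ₂) (F-size : HasSize (HeytingField.setoid F) q)
  (V : Module (scalars F) m ℓm) where

  open VectorSpace F V
  open Module V
  open Sum +ᴹ-commutativeMonoid using (∑-distrib-+; sum-cong-≋)
  open AbelianGroupProperties +ᴹ-abelianGroup
    using (identityˡ-unique; inverseˡ-unique; ⁻¹-∙-comm; ⁻¹-anti-homo-//;
           x∙y⁻¹≈ε⇒x≈y; x≈y⇒x∙y⁻¹≈ε; //-rightDividesˡ; //-rightDividesʳ)
  open CommutativeSemigroupProperties
    (AbelianGroup.commutativeSemigroup +ᴹ-abelianGroup) using (interchange)
  private
    module F = HeytingField F
    module R = CommutativeRing (scalars F)
    module F-size = Size F-size
  open F using (Carrier; _≈_; 0#; 1#)
  open Subspace using (decidable; respects; 0∈; +-closed; *ₗ-closed)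
  private module ≈ᴹ-R = ≈-Reasoning ≈ᴹ-setoid

  private module F₊ = AbelianGroupProperties R.+-abelianGroup

  -- The field axioms link `a # 0#` to invertibility of `a - 0#`; this converts to invertibility of
  -- a.
  x-0≈x : ∀ a → a F.- 0# ≈ a
  x-0≈x a = F.trans (F.+-congˡ F₊.ε⁻¹≈ε) (F.+-identityʳ a)

  1≉0 : ¬ 1# ≈ 0#
  1≉0 1≈0 = F.#-irrefl 1≈0 (F.invertible⇒# (1# , inverse , F.trans (F.*-comm _ _) inverse))
    where
    inverse : 1# F.* (1# F.- 0#) ≈ 1#
    inverse = F.trans (F.*-identityˡ _) (x-0≈x 1#)

  -- Tightness yields only that a nonzero a cannot fail to be apart from 0, a double negation.
  -- Searching the finite field decides whether an inverse exists, which removes it.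
  leftInverse : ∀ {a} → ¬ a ≈ 0# → ∃[ b ] b F.* a ≈ 1#
  leftInverse {a} a≉0 = decidable-stable
    (F-size.search (λ b → F-size.≈-dec (b F.* a) 1#) λ b≈c ba≈1 → F.trans (F.*-congʳ (F.sym b≈c)) ba≈1)
    λ noninvertible → a≉0 (proj₁ (F.tight a 0#) λ a#0 →
      let b , b[a-0]≈1 , _ = F.#⇒invertible a#0
      in noninvertible (b , F.trans (F.*-congˡ (F.sym (x-0≈x a))) b[a-0]≈1))

  cancel-scalar : ∀ {a b} x → b F.* a ≈ 1# → b *ₗ (a *ₗ x) ≈ᴹ x
  cancel-scalar x ba≈1 =
    ≈ᴹ-trans (≈ᴹ-sym (*ₗ-assoc _ _ x)) (≈ᴹ-trans (*ₗ-congʳ ba≈1) (*ₗ-identityˡ x))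

  *ₗ-neg : ∀ a x → a *ₗ (-ᴹ x) ≈ᴹ -ᴹ (a *ₗ x)
  *ₗ-neg a x = inverseˡ-unique _ _
    (≈ᴹ-trans (≈ᴹ-sym (*ₗ-distribˡ a _ _)) (≈ᴹ-trans (*ₗ-congˡ (-ᴹ‿inverseˡ x)) (*ₗ-zeroʳ a)))

  neg≈-1* : ∀ x → (F.- 1#) *ₗ x ≈ᴹ -ᴹ x
  neg≈-1* x = inverseˡ-unique _ _ (begin
    (F.- 1#) *ₗ x +ᴹ x         ≈⟨ +ᴹ-congˡ (*ₗ-identityˡ x) ⟨
    (F.- 1#) *ₗ x +ᴹ 1# *ₗ x   ≈⟨ *ₗ-distribʳ x _ _ ⟨
    (F.- 1# F.+ 1#) *ₗ x       ≈⟨ *ₗ-congʳ (F.-‿inverseˡ 1#) ⟩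
    0# *ₗ x                    ≈⟨ *ₗ-zeroˡ x ⟩
    0ᴹ                         ∎)
    where open ≈ᴹ-R

  -- Dimension through cardinality

  HasDim-resp : ∀ {p r k} {P : Pred Carrierᴹ p} {R : Pred Carrierᴹ r} →
    P ≐ R → HasDim P k → HasDim R k
  HasDim-resp P≐R (v , independent , P≐Span) = v , independent , ≐-trans (≐-sym P≐R) P≐Span

  combination-injective : ∀ {k} {v : Vector Carrierᴹ k} → LinearlyIndependent v →
    ∀ a b → combination a v ≈ᴹ combination b v → ∀ i → a i ≈ b i
  combination-injective {k} {v} independent a b eq i = F₊.x∙y⁻¹≈ε⇒x≈y (a i) (b i)
    (independent (λ j → a j F.- b j) (identityˡ-unique _ _ (≈ᴹ-trans difference eq)) i)
    where
    difference : combination (λ j → a j F.- b j) v +ᴹ combination b v ≈ᴹ combination a v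
    difference = ≈ᴹ-trans (≈ᴹ-sym (∑-distrib-+ {k} _ (λ j → b j *ₗ v j))) (sum-cong-≋ λ j →
      ≈ᴹ-trans (≈ᴹ-sym (*ₗ-distribʳ (v j) _ _)) (*ₗ-congʳ (F₊.//-rightDividesˡ (b j) (a j))))

  -- Coordinates with respect to a basis are unique, and the k-tuples of scalars are coded by
  -- `Fin (q ^ k)`.
  HasDim⇒size : ∀ {p k} {P : Pred Carrierᴹ p} → HasDim P k → HasSize (subsetoid ≈ᴹ-setoid P) (q ^ k)
  HasDim⇒size {k = k} {P} (v , independent , P⊆Span , Span⊆P) = enumeration⇒size
    (λ i → combination (coefficients i) v , Span⊆P (coefficients i , ≈ᴹ-refl))
    (λ i j eq → ≡.trans (≡.sym (funToFin-finToFin {k} {q} i)) (≡.trans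
      (funToFin-cong λ l → F-size.from-injective _ _
        (combination-injective independent (coefficients i) (coefficients j) eq l))
      (funToFin-finToFin {k} {q} j)))
    (λ (x , x∈P) → let a , x≈av = P⊆Span x∈P in
      funToFin (F-size.to ∘ a) ,
      ≈ᴹ-trans (sum-cong-≋ λ l → *ₗ-congʳ (F.trans
        (F.reflexive (cong F-size.from (finToFun-funToFin (F-size.to ∘ a) l))) (F-size.from-to (a l))))
      (≈ᴹ-sym x≈av))
    where
    coefficients : Fin (q ^ k) → Vector Carrier k
    coefficients i = F-size.from ∘ finToFun i

  -- Counting elements gives q ^ a ≤ q ^ b, which takes the place of the exchange lemma.
  HasDim-mono : ∀ {p r a b} {P : Pred Carrierᴹ p} {R : Pred Carrierᴹ r} →
    P ⊆ R → HasDim P a → HasDim R b → a ≤ b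
  HasDim-mono P⊆R P-dim R-dim = ^-cancel-≤ 1<q
    (size-mono (HasDim⇒size P-dim) (HasDim⇒size R-dim) (λ (x , x∈P) → x , P⊆R x∈P) id)

  HasDim-unique : ∀ {p a b} {P : Pred Carrierᴹ p} → HasDim P a → HasDim P b → a ≡ b
  HasDim-unique P-dim P-dim′ = ℕₚ.≤-antisym (HasDim-mono id P-dim P-dim′) (HasDim-mono id P-dim′ P-dim)

  -- Congruence modulo a subspace

  -ᴹ-closed : ∀ W {x} → x ∈ ⟪ W ⟫ → -ᴹ x ∈ ⟪ W ⟫
  -ᴹ-closed W x∈W = respects W (neg≈-1* _) (*ₗ-closed W (F.- 1#) x∈W)

  infix 4 _∼[_]_

  _∼[_]_ : Carrierᴹ → Subspace → Carrierᴹ → Set sl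
  x ∼[ W ] y = x +ᴹ -ᴹ y ∈ ⟪ W ⟫

  module _ (W : Subspace) where

    ∼-reflexive : ∀ {x y} → x ≈ᴹ y → x ∼[ W ] y
    ∼-reflexive x≈y = respects W (≈ᴹ-sym (x≈y⇒x∙y⁻¹≈ε x≈y)) (0∈ W)

    ∼-sym : ∀ {x y} → x ∼[ W ] y → y ∼[ W ] x
    ∼-sym x∼y = respects W (⁻¹-anti-homo-// _ _) (-ᴹ-closed W x∼y)

    ∼-trans : ∀ {x y z} → x ∼[ W ] y → y ∼[ W ] z → x ∼[ W ] z
    ∼-trans {x} {y} {z} x∼y y∼z = respects W
      (≈ᴹ-trans (≈ᴹ-sym (+ᴹ-assoc _ _ _)) (+ᴹ-congʳ (//-rightDividesˡ y x)))
      (+-closed W x∼y y∼z)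

    ∼-+ : ∀ {x y x′ y′} → x ∼[ W ] y → x′ ∼[ W ] y′ → x +ᴹ x′ ∼[ W ] y +ᴹ y′
    ∼-+ x∼y x′∼y′ = respects W
      (≈ᴹ-trans (interchange _ _ _ _) (+ᴹ-congˡ (⁻¹-∙-comm _ _))) (+-closed W x∼y x′∼y′)

    ∼-* : ∀ a {x y} → x ∼[ W ] y → a *ₗ x ∼[ W ] a *ₗ y
    ∼-* a x∼y = respects W
      (≈ᴹ-trans (*ₗ-distribˡ a _ _) (+ᴹ-congˡ (*ₗ-neg a _))) (*ₗ-closed W a x∼y)

    ∼-∈ : ∀ {x y} → x ∼[ W ] y → y ∈ ⟪ W ⟫ → x ∈ ⟪ W ⟫
    ∼-∈ x∼y y∈W = respects W (//-rightDividesˡ _ _) (+-closed W x∼y y∈W)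

    ∈-∼ : ∀ {x y} → x ∈ ⟪ W ⟫ → y ∈ ⟪ W ⟫ → x ∼[ W ] y
    ∈-∼ x∈W y∈W = +-closed W x∈W (-ᴹ-closed W y∈W)

  *ₗ-cancel-∈ : ∀ W {a x} → ¬ a ≈ 0# → a *ₗ x ∈ ⟪ W ⟫ → x ∈ ⟪ W ⟫
  *ₗ-cancel-∈ W a≉0 ax∈W = let b , ba≈1 = leftInverse a≉0 in
    respects W (cancel-scalar _ ba≈1) (*ₗ-closed W b ax∈W)

  -- Adjoining a vector to a subspace

  infixl 6 _⊕_

  -- The sum of W and the span of x. Membership is phrased as congruence to a multiple of x modulo
  -- W, so that deciding it takes only a search over the scalars.
  _⊕_ : Subspace → Carrierᴹ → Subspace
  W ⊕ x = record
    { members   = λ y → ∃[ a ] y ∼[ W ] a *ₗ x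
    ; decidable = λ y → F-size.search (λ a → decidable W (y +ᴹ -ᴹ (a *ₗ x)))
                    (λ a≈b y∼ax → ∼-trans W y∼ax (∼-reflexive W (*ₗ-congʳ a≈b)))
    ; respects  = λ y≈z (a , y∼ax) → a , ∼-trans W (∼-reflexive W (≈ᴹ-sym y≈z)) y∼ax
    ; 0∈        = 0# , ∼-reflexive W (≈ᴹ-sym (*ₗ-zeroˡ x))
    ; +-closed  = λ (a , y∼ax) (b , z∼bx) → a F.+ b ,
                    ∼-trans W (∼-+ W y∼ax z∼bx) (∼-reflexive W (≈ᴹ-sym (*ₗ-distribʳ x a b)))
    ; *ₗ-closed = λ b (a , y∼ax) → b F.* a ,
                    ∼-trans W (∼-* W b y∼ax) (∼-reflexive W (≈ᴹ-sym (*ₗ-assoc b a x)))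
    }

  ⊆⊕ : ∀ W x → ⟪ W ⟫ ⊆ ⟪ W ⊕ x ⟫
  ⊆⊕ W x y∈W = 0# , ∈-∼ W y∈W (respects W (≈ᴹ-sym (*ₗ-zeroˡ x)) (0∈ W))

  ∈⊕ : ∀ W x → x ∈ ⟪ W ⊕ x ⟫
  ∈⊕ W x = 1# , ∼-reflexive W (≈ᴹ-sym (*ₗ-identityˡ x))

  ⊕-least : ∀ W {x} S → ⟪ W ⟫ ⊆ ⟪ S ⟫ → x ∈ ⟪ S ⟫ → ⟪ W ⊕ x ⟫ ⊆ ⟪ S ⟫
  ⊕-least W S W⊆S x∈S (a , y∼ax) = ∼-∈ S (W⊆S y∼ax) (*ₗ-closed S a x∈S)

  ⊕-HasDim : ∀ {k} W {x} → x ∉ ⟪ W ⟫ → HasDim ⟪ W ⟫ k → HasDim ⟪ W ⊕ x ⟫ (suc k)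
  ⊕-HasDim W {x} x∉W (v , independent , W⊆Span , Span⊆W) =
    x ∷ v , independent′ ,
    (λ {y} (a , y∼ax) → let b , eq = W⊆Span y∼ax in (a ∷ b) , (begin
      y                                  ≈⟨ //-rightDividesˡ (a *ₗ x) y ⟨
      y +ᴹ -ᴹ (a *ₗ x) +ᴹ a *ₗ x         ≈⟨ +ᴹ-congʳ eq ⟩
      combination b v +ᴹ a *ₗ x          ≈⟨ +ᴹ-comm _ _ ⟩
      a *ₗ x +ᴹ combination b v          ∎)) ,
    (λ (a , y≈) → a zero , ∼-trans W (∼-reflexive W y≈) (head∼ a))
    where
    open ≈ᴹ-R
    head∼ : ∀ a → combination a (x ∷ v) ∼[ W ] a zero *ₗ x
    head∼ a = ∼-trans W
      (∼-+ W (∼-reflexive W ≈ᴹ-refl) (∈-∼ W (Span⊆W (a ∘ suc , ≈ᴹ-refl)) (0∈ W)))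
      (∼-reflexive W (+ᴹ-identityʳ _))
    independent′ : LinearlyIndependent (x ∷ v)
    independent′ a eq = λ { zero → a₀≈0 ; (suc i) → independent (a ∘ suc) tail≈0 i }
      where
      -- The vanishing combination is congruent to `a zero *ₗ x` modulo W, so an invertible `a zero`
      -- would put x into W.
      a₀≈0 : a zero ≈ 0#
      a₀≈0 = decidable-stable (F-size.≈-dec _ _) λ a₀≉0 → x∉W (*ₗ-cancel-∈ W a₀≉0
        (∼-∈ W (∼-trans W (∼-sym W (head∼ a)) (∼-reflexive W eq)) (0∈ W)))
      tail≈0 : combination (a ∘ suc) v ≈ᴹ 0ᴹ
      tail≈0 = begin
        combination (a ∘ suc) v               ≈⟨ +ᴹ-identityˡ _ ⟨
        0ᴹ +ᴹ combination (a ∘ suc) v         ≈⟨ +ᴹ-congʳ (≈ᴹ-trans (*ₗ-congʳ a₀≈0) (*ₗ-zeroˡ x)) ⟨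
        combination a (x ∷ v)                 ≈⟨ eq ⟩
        0ᴹ                                    ∎

  -- Chains of subspaces and dimension

  module FiniteDimensional {n : ℕ} (V-dim : HasDim U n) where

    private module V-size = Size (HasDim⇒size V-dim)

    ≈ᴹ-dec : ∀ x y → Dec (x ≈ᴹ y)
    ≈ᴹ-dec x y = V-size.≈-dec (x , tt) (y , tt)

    ⊆-or-witness : ∀ (A B : Subspace) → ⟪ A ⟫ ⊆ ⟪ B ⟫ ⊎ ∃[ x ] x ∈ ⟪ A ⟫ ∖ ⟪ B ⟫
    ⊆-or-witness A B
      with V-size.search {P = λ (x , _) → x ∈ ⟪ A ⟫ ∖ ⟪ B ⟫}
             (λ (x , _) → decidable A x ×-dec ¬? (decidable B x))
             (λ x≈y (x∈A , x∉B) → respects A x≈y x∈A , λ y∈B → x∉B (respects B (≈ᴹ-sym x≈y) y∈B))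
    ... | yes ((x , _) , x∈A∖B) = inj₂ (x , x∈A∖B)
    ... | no ∄x = inj₁ λ {x} x∈A → decidable-stable (decidable B x) λ x∉B → ∄x ((x , tt) , x∈A , x∉B)

    ⊈⇒witness : ∀ (A B : Subspace) → ⟪ A ⟫ ⊈ ⟪ B ⟫ → ∃[ x ] x ∈ ⟪ A ⟫ ∖ ⟪ B ⟫
    ⊈⇒witness A B A⊈B with ⊆-or-witness A B
    ... | inj₁ A⊆B     = ⊥-elim (A⊈B A⊆B)
    ... | inj₂ witness = witness

    𝟎 : Subspace
    𝟎 = record
      { members   = λ x → Lift sl (x ≈ᴹ 0ᴹ)
      ; decidable = λ x → map′ lift lower (≈ᴹ-dec x 0ᴹ)
      ; respects  = λ x≈y (lift x≈0) → lift (≈ᴹ-trans (≈ᴹ-sym x≈y) x≈0)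
      ; 0∈        = lift ≈ᴹ-refl
      ; +-closed  = λ (lift x≈0) (lift y≈0) → lift (≈ᴹ-trans (+ᴹ-cong x≈0 y≈0) (+ᴹ-identityˡ 0ᴹ))
      ; *ₗ-closed = λ a (lift x≈0) → lift (≈ᴹ-trans (*ₗ-congˡ x≈0) (*ₗ-zeroʳ a))
      }

    𝟎-HasDim : HasDim ⟪ 𝟎 ⟫ 0
    𝟎-HasDim = (λ ()) , (λ _ _ ()) , (λ (lift x≈0) → (λ ()) , x≈0) , (λ (_ , x≈0) → lift x≈0)

    𝟎⊆ : ∀ W → ⟪ 𝟎 ⟫ ⊆ ⟪ W ⟫
    𝟎⊆ W (lift x≈0) = respects W (≈ᴹ-sym x≈0) (0∈ W)

    -- A strict chain of length k from A to B that adjoins one vector at a time. It ends up to `≐`,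
    -- the equality of subspaces. Besides giving dimensions, it supports induction over the
    -- intermediate subspaces, as joins and polarities require.
    data Extension (A : Subspace) : ℕ → Subspace → Set (lsuc sl) where
      done : ∀ {B} → ⟪ A ⟫ ≐ ⟪ B ⟫ → Extension A 0 B
      step : ∀ {k B} x → x ∉ ⟪ A ⟫ → Extension (A ⊕ x) k B → Extension A (suc k) B

    Extension-⊆ : ∀ {A k B} → Extension A k B → ⟪ A ⟫ ⊆ ⟪ B ⟫
    Extension-⊆ (done (A⊆B , _))     x∈A = A⊆B x∈A
    Extension-⊆ {A} (step x _ A⊕x→B) y∈A = Extension-⊆ {A ⊕ x} A⊕x→B (⊆⊕ A x y∈A)

    Extension-∋ : ∀ A x {k B} → Extension (A ⊕ x) k B → x ∈ ⟪ B ⟫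
    Extension-∋ A x A⊕x→B = Extension-⊆ {A ⊕ x} A⊕x→B (∈⊕ A x)

    Extension-HasDim : ∀ {A k B d} → Extension A k B → HasDim ⟪ A ⟫ d → HasDim ⟪ B ⟫ (k + d)
    Extension-HasDim (done A≐B) A-dim = HasDim-resp A≐B A-dim
    Extension-HasDim {A} {suc k} {B} {d} (step x x∉A A⊕x→B) A-dim =
      subst (HasDim ⟪ B ⟫) (ℕₚ.+-suc k d) (Extension-HasDim {A ⊕ x} A⊕x→B (⊕-HasDim A x∉A A-dim))

    extension : ∀ {A d} B → ⟪ A ⟫ ⊆ ⟪ B ⟫ → HasDim ⟪ A ⟫ d → ∃[ k ] Extension A k B
    extension {A} {d} B A⊆B A-dim = go A n (ℕₚ.m≤n+m n d) A⊆B A-dim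
      where
      -- The bound `n ≤ d + fuel` is kept because every step raises d by one. With no fuel left, a
      -- further step would produce a subspace of dimension above n.
      go : ∀ {d} A fuel → n ≤ d + fuel → ⟪ A ⟫ ⊆ ⟪ B ⟫ → HasDim ⟪ A ⟫ d → ∃[ k ] Extension A k B
      go {d} A fuel n≤ A⊆B A-dim with ⊆-or-witness B A
      ... | inj₁ B⊆A = 0 , done (A⊆B , B⊆A)
      go {d} A zero n≤ A⊆B A-dim | inj₂ (x , x∈B , x∉A) = contradiction
        (HasDim-mono (λ _ → tt) (⊕-HasDim A x∉A A-dim) V-dim)
        (ℕₚ.≤⇒≯ (subst (n ≤_) (ℕₚ.+-identityʳ d) n≤))
      go {d} A (suc fuel) n≤ A⊆B A-dim | inj₂ (x , x∈B , x∉A) =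
        let k , A⊕x→B = go (A ⊕ x) fuel (subst (n ≤_) (ℕₚ.+-suc d fuel) n≤)
                          (⊕-least A B A⊆B x∈B) (⊕-HasDim A x∉A A-dim)
        in suc k , step x x∉A A⊕x→B

    filtration : ∀ W → ∃[ k ] Extension 𝟎 k W
    filtration W = extension W (𝟎⊆ W) 𝟎-HasDim

    dimension : ∀ W → ∃[ k ] HasDim ⟪ W ⟫ k
    dimension W = let k , 𝟎→W = filtration W in k + 0 , Extension-HasDim 𝟎→W 𝟎-HasDim

    HasDim⇒filtration : ∀ {W k} → HasDim ⟪ W ⟫ k → Extension 𝟎 k W
    HasDim⇒filtration {W} W-dim = let k , 𝟎→W = filtration W in
      subst (λ k → Extension 𝟎 k W)
        (HasDim-unique (subst (HasDim ⟪ W ⟫) (ℕₚ.+-identityʳ k) (Extension-HasDim 𝟎→W 𝟎-HasDim)) W-dim)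
        𝟎→W

    HasDim-mono-< : ∀ {A B a b} → ⟪ A ⟫ ⊆ ⟪ B ⟫ → ⟪ B ⟫ ⊈ ⟪ A ⟫ →
      HasDim ⟪ A ⟫ a → HasDim ⟪ B ⟫ b → a < b
    HasDim-mono-< {A} {B} A⊆B B⊈A A-dim B-dim =
      let x , x∈B , x∉A = ⊈⇒witness B A B⊈A
      in HasDim-mono (⊕-least A B A⊆B x∈B) (⊕-HasDim A x∉A A-dim) B-dim

    equal-dim-⊇ : ∀ {A B d} → ⟪ A ⟫ ⊆ ⟪ B ⟫ → HasDim ⟪ A ⟫ d → HasDim ⟪ B ⟫ d → ⟪ B ⟫ ⊆ ⟪ A ⟫
    equal-dim-⊇ {A} {B} A⊆B A-dim B-dim with ⊆-or-witness B A
    ... | inj₁ B⊆A             = B⊆A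
    ... | inj₂ (x , x∈B , x∉A) =
      ⊥-elim (ℕₚ.<-irrefl refl (HasDim-mono-< {A} {B} A⊆B (λ B⊆A → x∉A (B⊆A x∈B)) A-dim B-dim))

    -- Joins and the modular law

    -- Characterised by order alone, since inclusions are all that a polarity is known to reverse.
    IsJoin : Subspace → Subspace → Subspace → Set (lsuc sl)
    IsJoin A B J = ⟪ A ⟫ ⊆ ⟪ J ⟫ × ⟪ B ⟫ ⊆ ⟪ J ⟫ ×
      (∀ S → ⟪ A ⟫ ⊆ ⟪ S ⟫ → ⟪ B ⟫ ⊆ ⟪ S ⟫ → ⟪ J ⟫ ⊆ ⟪ S ⟫)

    -- A chain from A ∩ B to A can be followed step by step starting at B:
    -- as long as K ∩ A ⊆ I, a vector of A outside I is also outside K.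
    join-extension : ∀ A B → ∃[ k ] Extension (A ⊓ B) k A ×
      ∃[ J ] IsJoin A B J × Extension B k J
    join-extension A B =
      let _ , A⊓B-dim = dimension (A ⊓ B)
          k , A⊓B→A = extension A proj₁ A⊓B-dim
          J , A⊆J , least , B→J = go A⊓B→A proj₁ proj₂ (λ y∈A y∈B → y∈A , y∈B)
      in k , A⊓B→A , J , (A⊆J , Extension-⊆ B→J , λ S A⊆S B⊆S → least S A⊆S B⊆S) , B→J
      where
      go : ∀ {I k K} → Extension I k A → ⟪ I ⟫ ⊆ ⟪ A ⟫ → ⟪ I ⟫ ⊆ ⟪ K ⟫ →
        (∀ {y} → y ∈ ⟪ A ⟫ → y ∈ ⟪ K ⟫ → y ∈ ⟪ I ⟫) →
        ∃[ J ] ⟪ A ⟫ ⊆ ⟪ J ⟫ ×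
          (∀ S → ⟪ A ⟫ ⊆ ⟪ S ⟫ → ⟪ K ⟫ ⊆ ⟪ S ⟫ → ⟪ J ⟫ ⊆ ⟪ S ⟫) × Extension K k J
      go {K = K} (done (_ , A⊆I)) I⊆A I⊆K K∩A⊆I =
        K , (λ y∈A → I⊆K (A⊆I y∈A)) , (λ _ _ K⊆S → K⊆S) , done ≐-refl
      go {I} {suc k} {K} (step x x∉I I⊕x→A) I⊆A I⊆K K∩A⊆I =
        let J , A⊆J , least , K⊕x→J = go I⊕x→A
              (⊕-least I A I⊆A x∈A)
              (⊕-least I (K ⊕ x) (λ y∈I → ⊆⊕ K x (I⊆K y∈I)) (∈⊕ K x))
              (λ y∈A (a , y∼ax) → a , K∩A⊆I (∈-∼ A y∈A (*ₗ-closed A a x∈A)) y∼ax)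
        in J , A⊆J ,
           (λ S A⊆S K⊆S → least S A⊆S (⊕-least K S K⊆S (A⊆S x∈A))) ,
           step x (λ x∈K → x∉I (K∩A⊆I x∈A x∈K)) K⊕x→J
        where
        x∈A : x ∈ ⟪ A ⟫
        x∈A = Extension-∋ I x I⊕x→A

    -- The chains from A ∩ B to A and from B to the join have the same length k, so k + d = a and j
    -- = k + b.
    modular-law : ∀ {a b d} A B → HasDim ⟪ A ⟫ a → HasDim ⟪ B ⟫ b → HasDim ⟪ A ⊓ B ⟫ d →
      ∃[ J ] ∃[ j ] IsJoin A B J × HasDim ⟪ J ⟫ j × j + d ≡ a + b
    modular-law {a} {b} {d} A B A-dim B-dim A⊓B-dim =
      let k , A⊓B→A , J , J-join , B→J = join-extension A B
          k+d≡a = HasDim-unique (Extension-HasDim A⊓B→A A⊓B-dim) A-dim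
      in J , k + b , J-join , Extension-HasDim B→J B-dim ,
         ≡.trans (swap k b d) (cong (_+ b) k+d≡a)
      where
      swap : ∀ k b d → (k + b) + d ≡ (k + d) + b
      swap = ℕ-solver.solve-∀

    -- Points and their number

    point-⊆ : ∀ ((L , _) : Point) {w} S → w ∈ ⟪ L ⟫ → ¬ w ≈ᴹ 0ᴹ → w ∈ ⟪ S ⟫ → ⟪ L ⟫ ⊆ ⟪ S ⟫
    point-⊆ (L , _ , v , _ , L⊆Span , _) {w} S w∈L w≉0 w∈S {y} y∈L =
      let a , y≈av = L⊆Span y∈L
          c , w≈cv = L⊆Span w∈L
          -- As w is `c zero` times the generator `v zero` of L, a nonzero w makes `c zero`
          -- invertible, and w generates L as well.
          c≉0 : ¬ c zero ≈ 0#
          c≉0 c≈0 = w≉0 (≈ᴹ-trans w≈cv (≈ᴹ-trans (+ᴹ-identityʳ _)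
            (≈ᴹ-trans (*ₗ-congʳ c≈0) (*ₗ-zeroˡ _))))
          g∈S : v zero ∈ ⟪ S ⟫
          g∈S = *ₗ-cancel-∈ S c≉0 (respects S (≈ᴹ-trans w≈cv (+ᴹ-identityʳ _)) w∈S)
      in respects S (≈ᴹ-sym (≈ᴹ-trans y≈av (+ᴹ-identityʳ _))) (*ₗ-closed S (a zero) g∈S)

    nonzero∈ : ∀ ((L , _) : Point) → ∃[ w ] w ∈ ⟪ L ⟫ × ¬ w ≈ᴹ 0ᴹ
    nonzero∈ (L , _ , v , independent , _ , Span⊆L) =
      v zero ,
      Span⊆L ((λ _ → 1#) , ≈ᴹ-sym (≈ᴹ-trans (+ᴹ-identityʳ _) (*ₗ-identityˡ _))) ,
      λ v≈0 → 1≉0 (independent (λ _ → 1#)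
        (≈ᴹ-trans (+ᴹ-identityʳ _) (≈ᴹ-trans (*ₗ-identityˡ _) v≈0)) zero)

    point-⊓≈0 : ∀ ((L , _) : Point) {u w} H →
      u ∈ ⟪ L ⟫ → u ∉ ⟪ H ⟫ → w ∈ ⟪ L ⟫ → w ∈ ⟪ H ⟫ → w ≈ᴹ 0ᴹ
    point-⊓≈0 L {w = w} H u∈L u∉H w∈L w∈H =
      decidable-stable (≈ᴹ-dec w 0ᴹ) λ w≉0 → u∉H (point-⊆ L H w∈L w≉0 w∈H u∈L)

    line : ∀ w → ¬ w ≈ᴹ 0ᴹ → Point
    line w w≉0 = 𝟎 ⊕ w , (λ _ → tt) , ⊕-HasDim 𝟎 (λ (lift w≈0) → w≉0 w≈0) 𝟎-HasDim

    line-⊆ : ∀ {w} S → w ∈ ⟪ S ⟫ → ⟪ 𝟎 ⊕ w ⟫ ⊆ ⟪ S ⟫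
    line-⊆ S = ⊕-least 𝟎 S (𝟎⊆ S)

    ∉⇒≉0 : ∀ W {x} → x ∉ ⟪ W ⟫ → ¬ x ≈ᴹ 0ᴹ
    ∉⇒≉0 W x∉W x≈0 = x∉W (respects W (≈ᴹ-sym x≈0) (0∈ W))

    -- The line through y meets H only in 0, and 0 lies in X.
    line-⊆-∪ : ∀ H X Y {y} → y ∈ ⟪ Y ⟫ → y ∉ ⟪ H ⟫ → ⟪ 𝟎 ⊕ y ⟫ ⊆ ⟪ X ⟫ ∪ (⟪ Y ⟫ ∖ ⟪ H ⟫)
    line-⊆-∪ H X Y {y} y∈Y y∉H {x} x∈L with decidable H x
    ... | yes x∈H = inj₁ (𝟎⊆ X (lift (point-⊓≈0 (line y (∉⇒≉0 H y∉H)) H (∈⊕ 𝟎 y) y∉H x∈L x∈H)))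
    ... | no  x∉H = inj₂ (line-⊆ Y y∈Y x∈L , x∉H)

    points-size-resp : ∀ {p r k} {P : Pred Point p} {R : Pred Point r} → P ≐ R →
      HasSize (subsetoid points P) k → HasSize (subsetoid points R) k
    points-size-resp = subsetoid-size-resp points

    []-mono : ∀ {S T : Pred Carrierᴹ sl} → S ⊆ T → [ S ] ⊆ [ T ]
    []-mono S⊆T L⊆S x∈L = S⊆T (L⊆S x∈L)

    []-cong : ∀ {S T : Pred Carrierᴹ sl} → S ≐ T → [ S ] ≐ [ T ]
    []-cong {S} {T} (S⊆T , T⊆S) = (λ {L} → []-mono {S} {T} S⊆T {L}) , λ {L} → []-mono {T} {S} T⊆S {L}

    []-size-resp : ∀ {k} {S T : Pred Carrierᴹ sl} → S ≐ T →
      HasSize (subsetoid points [ S ]) k → HasSize (subsetoid points [ T ]) k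
    []-size-resp {S = S} {T} S≐T = points-size-resp {P = [ S ]} {R = [ T ]} ([]-cong {S} {T} S≐T)

    -- A point outside H contained in Z ⊕ y has exactly one vector in Z + y,
    -- since it meets H only in 0.
    points-size-⊕ : ∀ {s t} (H X Z : Subspace) {y} →
      ⟪ X ⟫ ⊆ ⟪ H ⟫ → ⟪ Z ⟫ ⊆ ⟪ H ⟫ → y ∉ ⟪ H ⟫ →
      HasSize (subsetoid points [ ⟪ X ⟫ ]) s → HasSize (subsetoid ≈ᴹ-setoid ⟪ Z ⟫) t →
      HasSize (subsetoid points [ ⟪ X ⟫ ∪ (⟪ Z ⊕ y ⟫ ∖ ⟪ H ⟫) ]) (s + t)
    points-size-⊕ {s} {t} H X Z {y} X⊆H Z⊆H y∉H X-size Z-size =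
      ⊎-enumeration⇒size enum enum-injective enum-surjective
      where
      module X = Size X-size
      module Z = Size Z-size

      T : Pred Carrierᴹ sl
      T = ⟪ X ⟫ ∪ (⟪ Z ⊕ y ⟫ ∖ ⟪ H ⟫)

      z+y∉H : ∀ {z} → z ∈ ⟪ Z ⟫ → z +ᴹ y ∉ ⟪ H ⟫
      z+y∉H {z} z∈Z z+y∈H = y∉H (respects H
        (≈ᴹ-trans (+ᴹ-congʳ (+ᴹ-comm z y)) (//-rightDividesʳ z y)) (∈-∼ H z+y∈H (Z⊆H z∈Z)))

      z+y∈Z⊕y : ∀ {z} → z ∈ ⟪ Z ⟫ → z +ᴹ y ∈ ⟪ Z ⊕ y ⟫
      z+y∈Z⊕y z∈Z = +-closed (Z ⊕ y) (⊆⊕ Z y z∈Z) (∈⊕ Z y)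

      zⱼ+y : Fin t → Carrierᴹ
      zⱼ+y j = proj₁ (Z.from j) +ᴹ y

      zⱼ+y∉H : ∀ j → zⱼ+y j ∉ ⟪ H ⟫
      zⱼ+y∉H j = z+y∉H (proj₂ (Z.from j))

      ∉H-unique : ∀ (L : Point) {z z′} → z ∈ ⟪ Z ⟫ → z′ ∈ ⟪ Z ⟫ →
        z +ᴹ y ∈ ⟪ proj₁ L ⟫ → z′ +ᴹ y ∈ ⟪ proj₁ L ⟫ → z ≈ᴹ z′
      ∉H-unique L {z} {z′} z∈Z z′∈Z z+y∈L z′+y∈L = x∙y⁻¹≈ε⇒x≈y z z′
        (point-⊓≈0 L H z+y∈L (z+y∉H z∈Z)
          (respects (proj₁ L) difference (∈-∼ (proj₁ L) z+y∈L z′+y∈L)) (∈-∼ H (Z⊆H z∈Z) (Z⊆H z′∈Z)))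
        where
        difference : z +ᴹ y +ᴹ -ᴹ (z′ +ᴹ y) ≈ᴹ z +ᴹ -ᴹ z′
        difference = ≈ᴹ-trans (+ᴹ-congˡ (≈ᴹ-sym (⁻¹-∙-comm z′ y)))
          (≈ᴹ-trans (interchange _ _ _ _) (≈ᴹ-trans (+ᴹ-congˡ (-ᴹ‿inverseʳ y)) (+ᴹ-identityʳ _)))

      enum : Fin s ⊎ Fin t → Σ Point [ T ]
      enum (inj₁ i) = let L , L⊆X = X.from i in L , λ x∈L → inj₁ (L⊆X x∈L)
      enum (inj₂ j) = line (zⱼ+y j) (∉⇒≉0 H (zⱼ+y∉H j)) ,
        line-⊆-∪ H X (Z ⊕ y) (z+y∈Z⊕y (proj₂ (Z.from j))) (zⱼ+y∉H j)

      enum-injective : ∀ i j → ⟪ proj₁ (proj₁ (enum i)) ⟫ ≐ ⟪ proj₁ (proj₁ (enum j)) ⟫ → i ≡ j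
      enum-injective (inj₁ i) (inj₁ j) eq = cong inj₁ (X.from-injective i j eq)
      enum-injective (inj₁ i) (inj₂ j) (_ , L⊆Lᵢ) =
        ⊥-elim (zⱼ+y∉H j (X⊆H (proj₂ (X.from i) (L⊆Lᵢ (∈⊕ 𝟎 (zⱼ+y j))))))
      enum-injective (inj₂ i) (inj₁ j) (L⊆Lⱼ , _) =
        ⊥-elim (zⱼ+y∉H i (X⊆H (proj₂ (X.from j) (L⊆Lⱼ (∈⊕ 𝟎 (zⱼ+y i))))))
      enum-injective (inj₂ i) (inj₂ j) (Lᵢ⊆Lⱼ , _) = cong inj₂ (Z.from-injective i j
        (∉H-unique (proj₁ (enum (inj₂ j))) (proj₂ (Z.from i)) (proj₂ (Z.from j))
          (Lᵢ⊆Lⱼ (∈⊕ 𝟎 (zⱼ+y i))) (∈⊕ 𝟎 (zⱼ+y j))))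

      enum-surjective : ∀ (L : Σ Point [ T ]) → ∃[ i ] ⟪ proj₁ (proj₁ (enum i)) ⟫ ≐ ⟪ proj₁ (proj₁ L) ⟫
      enum-surjective (L , L⊆T) with ⊆-or-witness (proj₁ L) H
      ... | inj₁ L⊆H = inj₁ (X.to L∈[X]) , X.from-to L∈[X]
        where
        L∈[X] : Σ Point [ ⟪ X ⟫ ]
        L∈[X] = L , λ x∈L → case L⊆T x∈L of λ
          { (inj₁ x∈X)       → x∈X
          ; (inj₂ (_ , x∉H)) → ⊥-elim (x∉H (L⊆H x∈L)) }
      ... | inj₂ (u , u∈L , u∉H) with L⊆T u∈L
      ...   | inj₁ u∈X              = ⊥-elim (u∉H (X⊆H u∈X))
      ...   | inj₂ ((a , u∼ay) , _) = inj₂ (Z.to (z , z∈Z)) ,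
        line-⊆ (proj₁ L) zⱼ+y∈L ,
        point-⊆ L (𝟎 ⊕ zⱼ+y j) zⱼ+y∈L (∉⇒≉0 H (zⱼ+y∉H j)) (∈⊕ 𝟎 (zⱼ+y j))
        where
        a≉0 : ¬ a ≈ 0#
        a≉0 a≈0 = u∉H (Z⊆H (∼-∈ Z
          (∼-trans Z u∼ay (∼-reflexive Z (≈ᴹ-trans (*ₗ-congʳ a≈0) (*ₗ-zeroˡ y)))) (0∈ Z)))
        -- Scaling u by the inverse of a makes its y-coefficient 1; subtracting y leaves the vector
        -- z of Z that indexes the point.
        b = proj₁ (leftInverse a≉0)
        z = b *ₗ u +ᴹ -ᴹ y
        z∈Z : z ∈ ⟪ Z ⟫
        z∈Z = ∼-trans Z (∼-* Z b u∼ay) (∼-reflexive Z (cancel-scalar y (proj₂ (leftInverse a≉0))))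
        j = Z.to (z , z∈Z)
        zⱼ+y∈L : zⱼ+y j ∈ ⟪ proj₁ L ⟫
        zⱼ+y∈L = respects (proj₁ L)
          (≈ᴹ-sym (≈ᴹ-trans (+ᴹ-congʳ (Z.from-to (z , z∈Z))) (//-rightDividesˡ y (b *ₗ u))))
          (*ₗ-closed (proj₁ L) b u∈L)

    -- The count follows a chain from 0 to W. A step from A to A ⊕ x adds the points outside A, one
    -- for each of the q ^ d vectors of A.
    points-size : ∀ W {k} → HasDim ⟪ W ⟫ k → HasSize (subsetoid points [ ⟪ W ⟫ ]) (pointCount q k)
    points-size W {k} W-dim = subst (λ k → HasSize (subsetoid points [ ⟪ W ⟫ ]) (pointCount q k))
      (ℕₚ.+-identityʳ k) (go (HasDim⇒filtration W-dim) 𝟎-HasDim 𝟎-size)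
      where
      𝟎-size : HasSize (subsetoid points [ ⟪ 𝟎 ⟫ ]) 0
      𝟎-size = enumeration⇒size (λ ()) (λ ()) λ (L , L⊆𝟎) →
        let w , w∈L , w≉0 = nonzero∈ L in ⊥-elim (w≉0 (lower (L⊆𝟎 w∈L)))
      go : ∀ {A k d} → Extension A k W → HasDim ⟪ A ⟫ d →
        HasSize (subsetoid points [ ⟪ A ⟫ ]) (pointCount q d) →
        HasSize (subsetoid points [ ⟪ W ⟫ ]) (pointCount q (k + d))
      go (done A≐W) A-dim A-size =
        []-size-resp A≐W A-size
      go {A} {suc k} {d} (step x x∉A A⊕x→W) A-dim A-size =
        subst (λ k → HasSize (subsetoid points [ ⟪ W ⟫ ]) (pointCount q k)) (ℕₚ.+-suc k d)
          (go A⊕x→W (⊕-HasDim A x∉A A-dim)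
            ([]-size-resp (toward , back)
              -- A itself plays the role of the hyperplane, of X and of Z.
              (points-size-⊕ A A A id id x∉A A-size (HasDim⇒size A-dim))))
        where
        toward : ⟪ A ⟫ ∪ (⟪ A ⊕ x ⟫ ∖ ⟪ A ⟫) ⊆ ⟪ A ⊕ x ⟫
        toward (inj₁ y∈A)       = ⊆⊕ A x y∈A
        toward (inj₂ (y∈ , _)) = y∈
        back : ⟪ A ⊕ x ⟫ ⊆ ⟪ A ⟫ ∪ (⟪ A ⊕ x ⟫ ∖ ⟪ A ⟫)
        back {y} y∈ with decidable A y
        ... | yes y∈A = inj₁ y∈A
        ... | no  y∉A = inj₂ (y∈ , y∉A)

    -- Both sides say that k = e. P is any set with as many points as Y has, such as the
    -- intersection of two blocks.
    HasDim⇔points-size : ∀ {p k} e {P : Pred Point p} Y → HasDim ⟪ Y ⟫ k →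
      HasSize (subsetoid points P) (pointCount q k) →
      HasDim ⟪ Y ⟫ e ⇔ HasSize (subsetoid points P) (pointCount q e)
    HasDim⇔points-size e {P} Y Y-dim P-size = mk⇔
      (λ Y-dim′ → subst (λ k → HasSize (subsetoid points P) (pointCount q k))
                  (HasDim-unique Y-dim Y-dim′) P-size)
      (λ P-size′ → subst (HasDim ⟪ Y ⟫) (pointCount-injective 1<q (size-unique P-size P-size′)) Y-dim)

    -- Polarities and dimension

    module Polar {h : ℕ} (H : Subspace) (H-dim : HasDim ⟪ H ⟫ h) (σ : Polarity H) where

      open Polarity σ

      ⟪_⟫ₕ : SubspaceOf H → Pred Carrierᴹ sl
      ⟪ W ⟫ₕ = ⟪ proj₁ W ⟫

      polar : SubspaceOf H → SubspaceOf H
      polar = Inverse.to permutation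

      polar-cong : ∀ A B → ⟪ A ⟫ₕ ≐ ⟪ B ⟫ₕ → ⟪ polar A ⟫ₕ ≐ ⟪ polar B ⟫ₕ
      polar-cong A B (A⊆B , B⊆A) = reversing B A B⊆A , reversing A B A⊆B

      polar-reflects : ∀ A B → ⟪ polar B ⟫ₕ ⊆ ⟪ polar A ⟫ₕ → ⟪ A ⟫ₕ ⊆ ⟪ B ⟫ₕ
      polar-reflects A B polarB⊆polarA x∈A =
        proj₁ (involutive B) (reversing (polar B) (polar A) polarB⊆polarA (proj₂ (involutive A) x∈A))

      -- Each step of the chain is strict, and so is its image because σ reflects inclusions; hence
      -- the dimension of the polar drops by at least one per step.
      polar-Extension : ∀ {k s t} (A B : SubspaceOf H) → Extension (proj₁ A) k (proj₁ B) →
        HasDim ⟪ polar A ⟫ₕ s → HasDim ⟪ polar B ⟫ₕ t → t + k ≤ s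
      polar-Extension {s = s} {t} A B (done (A⊆B , _)) polarA-dim polarB-dim =
        subst (_≤ s) (≡.sym (ℕₚ.+-identityʳ t)) (HasDim-mono (reversing A B A⊆B) polarB-dim polarA-dim)
      polar-Extension {suc k} {s} {t} A B (step x x∉A A⊕x→B) polarA-dim polarB-dim =
        let r , polarA′-dim = dimension (proj₁ (polar A′)) in begin
          t + suc k   ≡⟨ ℕₚ.+-suc t k ⟩
          suc (t + k) ≤⟨ s≤s (polar-Extension A′ B A⊕x→B polarA′-dim polarB-dim) ⟩
          suc r       ≤⟨ HasDim-mono-< {proj₁ (polar A′)} {proj₁ (polar A)} (reversing A A′ (⊆⊕ (proj₁ A) x))
                           (λ polarA⊆polarA′ → x∉A (polar-reflects A′ A polarA⊆polarA′ (∈⊕ (proj₁ A) x)))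
                           polarA′-dim polarA-dim ⟩
          s           ∎
        where
        open ℕₚ.≤-Reasoning
        A′ : SubspaceOf H
        A′ = proj₁ A ⊕ x , ⊕-least (proj₁ A) H (proj₂ A) (proj₂ B (Extension-∋ (proj₁ A) x A⊕x→B))

      -- The image of a chain from 0 to A gives s + d ≤ h, and that of a chain from A to H, of
      -- length h - d, gives h - d ≤ s.
      polar-dims : ∀ {d s} A → HasDim ⟪ A ⟫ₕ d → HasDim ⟪ polar A ⟫ₕ s → s + d ≡ h
      polar-dims {d} {s} A A-dim polarA-dim = ℕₚ.≤-antisym
        (let _ , polar𝟎-dim = dimension (proj₁ (polar 𝟎ₕ)) in ℕₚ.≤-trans
          (polar-Extension 𝟎ₕ A (HasDim⇒filtration A-dim) polar𝟎-dim polarA-dim)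
          (HasDim-mono (proj₂ (polar 𝟎ₕ)) polar𝟎-dim H-dim))
        (let k , A→H = extension H (proj₂ A) A-dim
             t , polarH-dim = dimension (proj₁ (polar Hₕ))
             k+d≡h = HasDim-unique (Extension-HasDim A→H A-dim) H-dim
         in subst (_≤ s + d) k+d≡h (ℕₚ.+-monoˡ-≤ d (ℕₚ.≤-trans (ℕₚ.m≤n+m k t)
              (polar-Extension A Hₕ A→H polarA-dim polarH-dim))))
        where
        𝟎ₕ Hₕ : SubspaceOf H
        𝟎ₕ = 𝟎 , 𝟎⊆ H
        Hₕ = H , id

      polar-HasDim : ∀ {d s} A → HasDim ⟪ A ⟫ₕ d → s + d ≡ h → HasDim ⟪ polar A ⟫ₕ s
      polar-HasDim {d} A A-dim s+d≡h = let t , polarA-dim = dimension (proj₁ (polar A)) in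
        subst (HasDim ⟪ polar A ⟫ₕ)
          (ℕₚ.+-cancelʳ-≡ d _ _ (≡.trans (polar-dims A A-dim polarA-dim) (≡.sym s+d≡h))) polarA-dim

      -- The intersection of the polars is the polar of the join J, so x + j = h; the modular law
      -- gives j + d = a + b.
      polar-⊓-dims : ∀ {a b d x} A B → HasDim ⟪ A ⟫ₕ a → HasDim ⟪ B ⟫ₕ b →
        HasDim ⟪ proj₁ A ⊓ proj₁ B ⟫ d →
        HasDim ⟪ proj₁ (polar A) ⊓ proj₁ (polar B) ⟫ x → x + (a + b) ≡ h + d
      polar-⊓-dims {a} {b} {d} {x} A B A-dim B-dim A⊓B-dim X-dim =
        let J , j , (A⊆J , B⊆J , least) , J-dim , j+d≡a+b =
              modular-law (proj₁ A) (proj₁ B) A-dim B-dim A⊓B-dim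
            Jₕ : SubspaceOf H
            Jₕ = J , least H (proj₂ A) (proj₂ B)
            -- Applying σ to X ⊆ σ(A) and X ⊆ σ(B) puts A and B, hence their join, inside σ(X).
            J⊆polarX : ⟪ J ⟫ ⊆ ⟪ polar X ⟫ₕ
            J⊆polarX = least (proj₁ (polar X))
              (λ y∈A → reversing X (polar A) proj₁ (proj₂ (involutive A) y∈A))
              (λ y∈B → reversing X (polar B) proj₂ (proj₂ (involutive B) y∈B))
            X≐polarJ : ⟪ X ⟫ₕ ≐ ⟪ polar Jₕ ⟫ₕ
            X≐polarJ = (λ y∈X → reversing Jₕ (polar X) J⊆polarX (proj₂ (involutive X) y∈X)) ,
                       (λ y∈ → reversing A Jₕ A⊆J y∈ , reversing B Jₕ B⊆J y∈)
        in begin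
          x + (a + b) ≡⟨ cong (x +_) j+d≡a+b ⟨
          x + (j + d) ≡⟨ ℕₚ.+-assoc x j d ⟨
          x + j + d   ≡⟨ cong (_+ d) (polar-dims Jₕ J-dim (HasDim-resp X≐polarJ X-dim)) ⟩
          h + d       ∎
        where
        open ≡.≡-Reasoning
        X : SubspaceOf H
        X = proj₁ (polar A) ⊓ proj₁ (polar B) , (λ (y∈polarA , _) → proj₂ (polar A) y∈polarA)

      -- Subspaces cut by the hyperplane

      module Hyperplane (n≡1+h : n ≡ suc h) where

        -- Otherwise adjoining both y and v to H would give dimension h + 2 > n.
        ∈H⊕ : ∀ {y} → y ∉ ⟪ H ⟫ → ∀ v → v ∈ ⟪ H ⊕ y ⟫
        ∈H⊕ {y} y∉H v = decidable-stable (decidable (H ⊕ y) v) λ v∉ →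
          ℕₚ.<⇒≱ (ℕₚ.≤-reflexive (cong suc n≡1+h))
            (HasDim-mono (λ _ → tt) (⊕-HasDim (H ⊕ y) v∉ (⊕-HasDim H y∉H H-dim)) V-dim)

        ⊓H⊕≐ : ∀ Y {y} → y ∈ ⟪ Y ⟫ → y ∉ ⟪ H ⟫ → ⟪ (Y ⊓ H) ⊕ y ⟫ ≐ ⟪ Y ⟫
        ⊓H⊕≐ Y {y} y∈Y y∉H = ⊕-least (Y ⊓ H) Y proj₁ y∈Y , λ {v} v∈Y →
          let a , v∼ay = ∈H⊕ y∉H v in a , ∈-∼ Y v∈Y (*ₗ-closed Y a y∈Y) , v∼ay

        ⊓H-HasDim : ∀ Y {d} → HasDim ⟪ Y ⟫ (suc d) → ⟪ Y ⟫ ⊈ ⟪ H ⟫ → HasDim ⟪ Y ⊓ H ⟫ d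
        ⊓H-HasDim Y Y-dim Y⊈H =
          let y , y∈Y , y∉H = ⊈⇒witness Y H Y⊈H
              d , Y⊓H-dim = dimension (Y ⊓ H)
              Y-dim′ = HasDim-resp (⊓H⊕≐ Y y∈Y y∉H) (⊕-HasDim (Y ⊓ H) (λ (_ , y∈H) → y∉H y∈H) Y⊓H-dim)
          in subst (HasDim ⟪ Y ⊓ H ⟫) (ℕₚ.suc-injective (HasDim-unique Y-dim′ Y-dim)) Y⊓H-dim

        -- Exchanging Y ∩ H for an X of the same dimension preserves the number of points of Y. If Y
        -- ⊆ H, only X remains and k = d. Otherwise Y is Y ∩ H with one vector adjoined, and k = d +
        -- 1.
        points-size-∪ : ∀ {d} X Y → ⟪ X ⟫ ⊆ ⟪ H ⟫ → HasDim ⟪ X ⟫ d → HasDim ⟪ Y ⊓ H ⟫ d →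
          ∃[ k ] HasDim ⟪ Y ⟫ k × HasSize (subsetoid points [ ⟪ X ⟫ ∪ (⟪ Y ⟫ ∖ ⟪ H ⟫) ]) (pointCount q k)
        points-size-∪ {d} X Y X⊆H X-dim Y⊓H-dim with ⊆-or-witness Y H
        ... | inj₁ Y⊆H = d , HasDim-resp (proj₁ , λ y∈Y → y∈Y , Y⊆H y∈Y) Y⊓H-dim ,
          []-size-resp (inj₁ , λ { (inj₁ x∈X) → x∈X ; (inj₂ (x∈Y , x∉H)) → ⊥-elim (x∉H (Y⊆H x∈Y)) })
            (points-size X X-dim)
        ... | inj₂ (y , y∈Y , y∉H) = suc d ,
          HasDim-resp Z⊕y≐Y (⊕-HasDim (Y ⊓ H) (λ (_ , y∈H) → y∉H y∈H) Y⊓H-dim) ,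
          []-size-resp
            ( (λ { (inj₁ x∈X) → inj₁ x∈X ; (inj₂ (x∈ , x∉H)) → inj₂ (proj₁ Z⊕y≐Y x∈ , x∉H) })
            , (λ { (inj₁ x∈X) → inj₁ x∈X ; (inj₂ (x∈ , x∉H)) → inj₂ (proj₂ Z⊕y≐Y x∈ , x∉H) }))
            (points-size-⊕ H X (Y ⊓ H) X⊆H proj₂ y∉H (points-size X X-dim) (HasDim⇒size Y⊓H-dim))
          where Z⊕y≐Y = ⊓H⊕≐ Y y∈Y y∉H

        -- The bijection between vertices and blocks

        module Isomorphism {e : ℕ} (2≤e : 2 ≤ e) (h≡2e : h ≡ 2 * e) where

          private
            Vertex : Set _
            Vertex = Σ Subspace (𝒜 H e ∪ ℬ H e)

            Block : Set _
            Block = Σ (Pred Point sl) (𝒜′ H e σ ∪ ℬ′ H e σ)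

          e+e≡h : e + e ≡ h
          e+e≡h = ≡.trans (cong (e +_) (≡.sym (ℕₚ.+-identityʳ e))) (≡.sym h≡2e)

          [e-1]+1≡e : e ∸ 1 + 1 ≡ e
          [e-1]+1≡e = ℕₚ.m∸n+n≡m (ℕₚ.≤-trans (s≤s z≤n) 2≤e)

          [e-2]+2≡e : e ∸ 2 + 2 ≡ e
          [e-2]+2≡e = ℕₚ.m∸n+n≡m 2≤e

          [e-1]+[e+1]≡h : (e ∸ 1) + (e + 1) ≡ h
          [e-1]+[e+1]≡h = ≡.trans (regroup (e ∸ 1) e) (≡.trans (cong (_+ e) [e-1]+1≡e) e+e≡h)
            where
            regroup : ∀ a b → a + (b + 1) ≡ (a + 1) + b
            regroup = ℕ-solver.solve-∀

          trace : Subspace → SubspaceOf H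
          trace W = W ⊓ H , proj₂

          trace-HasDim : ∀ W → W ∈ 𝒜 H e → HasDim ⟪ W ⊓ H ⟫ e
          trace-HasDim W ((_ , W-dim) , W⊈H) =
            ⊓H-HasDim W (subst (HasDim ⟪ W ⟫) (ℕₚ.+-comm e 1) W-dim) W⊈H

          polar-trace-HasDim : ∀ W → W ∈ 𝒜 H e → HasDim ⟪ polar (trace W) ⟫ₕ e
          polar-trace-HasDim W W∈𝒜 = polar-HasDim (trace W) (trace-HasDim W W∈𝒜) e+e≡h

          -- Agrees definitionally with the set in `𝒜′`, so that `≐-refl` proves its points to be a
          -- block.
          twisted : Subspace → Pred Carrierᴹ sl
          twisted W = ⟪ polar (trace W) ⟫ₕ ∪ (⟪ W ⟫ ∖ ⟪ H ⟫)

          toBlock : Vertex → Block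
          toBlock (W , inj₁ W∈𝒜) = [ twisted W ] , inj₁ (W , W∈𝒜 , ≐-refl)
          toBlock (W , inj₂ (W⊆H , W-dim)) = [ ⟪ polar Wₕ ⟫ₕ ] , inj₂
            ( proj₁ (polar Wₕ)
            , (proj₂ (polar Wₕ) , polar-HasDim Wₕ W-dim (≡.trans (ℕₚ.+-comm (e + 1) (e ∸ 1)) [e-1]+[e+1]≡h))
            , ≐-refl)
            where
            Wₕ : SubspaceOf H
            Wₕ = W , W⊆H

          toBlock-cong : ∀ (x y : Vertex) → ⟪ proj₁ x ⟫ ≐ ⟪ proj₁ y ⟫ →
            proj₁ (toBlock x) ≐ proj₁ (toBlock y)
          toBlock-cong (A , inj₁ _) (B , inj₁ _) (A⊆B , B⊆A) = []-cong {twisted A} {twisted B}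
            ( (λ { (inj₁ x∈) → inj₁ (proj₁ polars x∈) ; (inj₂ (x∈A , x∉H)) → inj₂ (A⊆B x∈A , x∉H) })
            , (λ { (inj₁ x∈) → inj₁ (proj₂ polars x∈) ; (inj₂ (x∈B , x∉H)) → inj₂ (B⊆A x∈B , x∉H) }))
            where
            polars : ⟪ polar (trace A) ⟫ₕ ≐ ⟪ polar (trace B) ⟫ₕ
            polars = polar-cong (trace A) (trace B)
              ((λ (x∈A , x∈H) → A⊆B x∈A , x∈H) , λ (x∈B , x∈H) → B⊆A x∈B , x∈H)
          toBlock-cong (A , inj₁ (_ , A⊈H)) (B , inj₂ (B⊆H , _)) (A⊆B , _) =
            ⊥-elim (A⊈H (λ x∈A → B⊆H (A⊆B x∈A)))
          toBlock-cong (A , inj₂ (A⊆H , _)) (B , inj₁ (_ , B⊈H)) (_ , B⊆A) =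
            ⊥-elim (B⊈H (λ x∈B → A⊆H (B⊆A x∈B)))
          toBlock-cong (A , inj₂ (A⊆H , _)) (B , inj₂ (B⊆H , _)) A≐B =
            []-cong {⟪ polar (A , A⊆H) ⟫ₕ} {⟪ polar (B , B⊆H) ⟫ₕ} (polar-cong (A , A⊆H) (B , B⊆H) A≐B)

          line∈twisted : ∀ W {x} (x∈W : x ∈ ⟪ W ⟫) (x∉H : x ∉ ⟪ H ⟫) →
            line x (∉⇒≉0 H x∉H) ∈ [ twisted W ]
          line∈twisted W x∈W x∉H = line-⊆-∪ H (proj₁ (polar (trace W))) W x∈W x∉H

          twisted-∉H : ∀ W {x} → x ∈ twisted W → x ∉ ⟪ H ⟫ → x ∈ ⟪ W ⟫
          twisted-∉H W (inj₁ x∈polar)   x∉H = ⊥-elim (x∉H (proj₂ (polar (trace W)) x∈polar))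
          twisted-∉H W (inj₂ (x∈W , _)) x∉H = x∈W

          -- The inclusion of blocks is tested on the line through y; σ(B ∩ H) lies in H and cannot
          -- contain y.
          outside-H : ∀ A B → [ twisted A ] ⊆ [ twisted B ] → ∀ {y} → y ∈ ⟪ A ⟫ → y ∉ ⟪ H ⟫ → y ∈ ⟪ B ⟫
          outside-H A B A⊆B {y} y∈A y∉H = twisted-∉H B
            (A⊆B {line y (∉⇒≉0 H y∉H)} (line∈twisted A y∈A y∉H) (∈⊕ 𝟎 y)) y∉H

          -- W is generated by W ∖ H, which is the part of the block outside H.
          twisted-reflects : ∀ A B → ⟪ A ⟫ ⊈ ⟪ H ⟫ → [ twisted A ] ⊆ [ twisted B ] → ⟪ A ⟫ ⊆ ⟪ B ⟫
          twisted-reflects A B A⊈H A⊆B {x} x∈A with decidable H x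
          ... | no  x∉H = outside-H A B (λ {L} → A⊆B {L}) x∈A x∉H
          ... | yes x∈H =
            let w , w∈A , w∉H = ⊈⇒witness A H A⊈H
                x+w∉H = λ x+w∈H → w∉H (respects H
                  (≈ᴹ-trans (+ᴹ-congʳ (+ᴹ-comm x w)) (//-rightDividesʳ x w)) (∈-∼ H x+w∈H x∈H))
            in respects B (//-rightDividesʳ w x)
                 (∈-∼ B (outside-H A B (λ {L} → A⊆B {L}) (+-closed A x∈A w∈A) x+w∉H)
                        (outside-H A B (λ {L} → A⊆B {L}) w∈A w∉H))

          []-reflects : ∀ A B → [ ⟪ A ⟫ ] ⊆ [ ⟪ B ⟫ ] → ⟪ A ⟫ ⊆ ⟪ B ⟫
          []-reflects A B [A]⊆[B] {x} x∈A with ≈ᴹ-dec x 0ᴹ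
          ... | yes x≈0 = 𝟎⊆ B (lift x≈0)
          ... | no  x≉0 = [A]⊆[B] {line x x≉0} (line-⊆ A x∈A) (∈⊕ 𝟎 x)

          -- A vector of A outside H spans a point of the first block that is not in H. This
          -- separates the images of `𝒜` and `ℬ`.
          twisted⊈polar : ∀ A (B : SubspaceOf H) → ⟪ A ⟫ ⊈ ⟪ H ⟫ → [ twisted A ] ⊈ [ ⟪ B ⟫ₕ ]
          twisted⊈polar A B A⊈H A⊆B = let w , w∈A , w∉H = ⊈⇒witness A H A⊈H in
            w∉H (proj₂ B (A⊆B {line w (∉⇒≉0 H w∉H)} (line∈twisted A w∈A w∉H) (∈⊕ 𝟎 w)))

          toBlock-injective : ∀ (x y : Vertex) → proj₁ (toBlock x) ≐ proj₁ (toBlock y) →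
            ⟪ proj₁ x ⟫ ≐ ⟪ proj₁ y ⟫
          toBlock-injective (A , inj₁ (_ , A⊈H)) (B , inj₁ (_ , B⊈H)) (A⊆B , B⊆A) =
            twisted-reflects A B A⊈H (λ {L} → A⊆B {L}) , twisted-reflects B A B⊈H (λ {L} → B⊆A {L})
          toBlock-injective (A , inj₁ (_ , A⊈H)) (B , inj₂ (B⊆H , _)) (A⊆B , _) =
            ⊥-elim (twisted⊈polar A (polar (B , B⊆H)) A⊈H (λ {L} → A⊆B {L}))
          toBlock-injective (A , inj₂ (A⊆H , _)) (B , inj₁ (_ , B⊈H)) (_ , B⊆A) =
            ⊥-elim (twisted⊈polar B (polar (A , A⊆H)) B⊈H (λ {L} → B⊆A {L}))
          toBlock-injective (A , inj₂ (A⊆H , _)) (B , inj₂ (B⊆H , _)) (A⊆B , B⊆A) =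
            polar-reflects Aₕ Bₕ ([]-reflects (proj₁ (polar Bₕ)) (proj₁ (polar Aₕ)) (λ {L} → B⊆A {L})) ,
            polar-reflects Bₕ Aₕ ([]-reflects (proj₁ (polar Aₕ)) (proj₁ (polar Bₕ)) (λ {L} → A⊆B {L}))
            where
            Aₕ Bₕ : SubspaceOf H
            Aₕ = A , A⊆H
            Bₕ = B , B⊆H

          toBlock-surjective : ∀ (B : Block) → ∃[ x ] proj₁ (toBlock x) ≐ proj₁ B
          toBlock-surjective (B , inj₁ (W , W∈𝒜 , B≐)) = (W , inj₁ W∈𝒜) , ≐-sym B≐
          toBlock-surjective (B , inj₂ (W , (W⊆H , W-dim) , B≐)) =
            -- The preimage of [W] is σ(W), of dimension 2e - (e + 1) = e - 1, because σ is an
            -- involution.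
            (proj₁ (polar Wₕ) , inj₂ (proj₂ (polar Wₕ) , polar-HasDim Wₕ W-dim [e-1]+[e+1]≡h)) ,
            ≐-trans ([]-cong {⟪ polar (polar Wₕ) ⟫ₕ} {⟪ W ⟫} (involutive Wₕ)) (≐-sym B≐)
            where
            Wₕ : SubspaceOf H
            Wₕ = W , W⊆H

          -- Intersections of blocks and adjacency

          ∩-size : ∀ {k} {S₁ S₂ T : Pred Carrierᴹ sl} → T ≐ S₁ ∩ S₂ →
            HasSize (subsetoid points [ T ]) k → HasSize (subsetoid points ([ S₁ ] ∩ [ S₂ ])) k
          ∩-size {S₁ = S₁} {S₂} {T} (T⊆S , S⊆T) = points-size-resp {P = [ T ]} {R = [ S₁ ] ∩ [ S₂ ]}
            ( (λ L⊆T → (λ x∈L → proj₁ (T⊆S (L⊆T x∈L))) , λ x∈L → proj₂ (T⊆S (L⊆T x∈L)))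
            , (λ (L⊆S₁ , L⊆S₂) x∈L → S⊆T (L⊆S₁ x∈L , L⊆S₂ x∈L)))

          Meets : Rel (Pred Point sl) _
          Meets B₁ B₂ = HasSize (subsetoid points (B₁ ∩ B₂)) (pointCount q e)

          Meets-sym : ∀ {B₁ B₂} → Meets B₁ B₂ → Meets B₂ B₁
          Meets-sym {B₁} {B₂} = points-size-resp {P = B₁ ∩ B₂} {R = B₂ ∩ B₁}
            ((λ (p , r) → r , p) , λ (p , r) → r , p)

          -- The blocks meet in the points of X together with the part of A ∩ B outside H, where X
          -- is the intersection of the polars of the traces. As the traces have dimension e and h =
          -- 2e, X has the dimension of A ∩ B ∩ H, so `points-size-∪` applies to Y = A ∩ B.
          twisted-twisted : ∀ A B → A ∈ 𝒜 H e → B ∈ 𝒜 H e →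
            HasDim (⟪ A ⟫ ∩ ⟪ B ⟫) e ⇔ Meets [ twisted A ] [ twisted B ]
          twisted-twisted A B A∈𝒜 B∈𝒜 =
            let d , Z-dim = dimension ((A ⊓ H) ⊓ (B ⊓ H))
                x , X-dim = dimension X
                x+2e≡h+d = polar-⊓-dims (trace A) (trace B)
                  (trace-HasDim A A∈𝒜) (trace-HasDim B B∈𝒜) Z-dim X-dim
                x≡d = ℕₚ.+-cancelʳ-≡ h x d (≡.trans (cong (x +_) (≡.sym e+e≡h))
                        (≡.trans x+2e≡h+d (ℕₚ.+-comm h d)))
                k , Y-dim , size = points-size-∪ X (A ⊓ B)
                  (λ (x∈ , _) → proj₂ (polar (trace A)) x∈) (subst (HasDim ⟪ X ⟫) x≡d X-dim)
                  (HasDim-resp ((λ ((x∈A , x∈H) , (x∈B , _)) → (x∈A , x∈B) , x∈H) ,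
                                (λ ((x∈A , x∈B) , x∈H) → (x∈A , x∈H) , (x∈B , x∈H))) Z-dim)
            in HasDim⇔points-size e {[ twisted A ] ∩ [ twisted B ]} (A ⊓ B) Y-dim
                 (∩-size {S₁ = twisted A} {twisted B} (T⊆ , ⊆T) size)
            where
            X = proj₁ (polar (trace A)) ⊓ proj₁ (polar (trace B))
            T = ⟪ X ⟫ ∪ (⟪ A ⊓ B ⟫ ∖ ⟪ H ⟫)
            T⊆ : T ⊆ twisted A ∩ twisted B
            T⊆ (inj₁ (x∈ , x∈′))         = inj₁ x∈ , inj₁ x∈′
            T⊆ (inj₂ ((x∈A , x∈B) , x∉H)) = inj₂ (x∈A , x∉H) , inj₂ (x∈B , x∉H)
            ⊆T : twisted A ∩ twisted B ⊆ T
            ⊆T (inj₁ x∈ , inj₁ x∈′)               = inj₁ (x∈ , x∈′)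
            ⊆T (inj₁ x∈ , inj₂ (_ , x∉H))         = ⊥-elim (x∉H (proj₂ (polar (trace A)) x∈))
            ⊆T (inj₂ (_ , x∉H) , inj₁ x∈)         = ⊥-elim (x∉H (proj₂ (polar (trace B)) x∈))
            ⊆T (inj₂ (x∈A , x∉H) , inj₂ (x∈B , _)) = inj₂ ((x∈A , x∈B) , x∉H)

          -- The second block lies in H, so the blocks meet in X = σ(A ∩ H) ∩ σ(B). Since σ(A ∩ H)
          -- has dimension e, X has dimension e exactly when σ(A ∩ H) ⊆ σ(B), that is, when B ⊆ A ∩
          -- H.
          twisted-polar : ∀ A (B : SubspaceOf H) → A ∈ 𝒜 H e →
            Lift (sl ⊔ ℓ₁) (⟪ B ⟫ₕ ⊆ ⟪ A ⟫) ⇔ Meets [ twisted A ] [ ⟪ polar B ⟫ₕ ]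
          twisted-polar A B A∈𝒜 =
            let x , X-dim = dimension X
                X-dim⇔ = HasDim⇔points-size e {[ twisted A ] ∩ [ ⟪ polar B ⟫ₕ ]} X X-dim
                  (∩-size {S₁ = twisted A} {⟪ polar B ⟫ₕ} {⟪ X ⟫} (X⊆ , ⊆X) (points-size X X-dim))
            in mk⇔ (Equivalence.to X-dim⇔ ∘ ⊆⇒X-dim) (X-dim⇒⊆ ∘ Equivalence.from X-dim⇔)
            where
            X = proj₁ (polar (trace A)) ⊓ proj₁ (polar B)
            polarA-dim = polar-trace-HasDim A A∈𝒜
            ⊆⇒X-dim : Lift (sl ⊔ ℓ₁) (⟪ B ⟫ₕ ⊆ ⟪ A ⟫) → HasDim ⟪ X ⟫ e
            ⊆⇒X-dim (lift B⊆A) = HasDim-resp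
              ((λ x∈ → x∈ , reversing B (trace A) (λ y∈B → B⊆A y∈B , proj₂ B y∈B) x∈) , proj₁) polarA-dim
            X-dim⇒⊆ : HasDim ⟪ X ⟫ e → Lift (sl ⊔ ℓ₁) (⟪ B ⟫ₕ ⊆ ⟪ A ⟫)
            X-dim⇒⊆ X-dim = lift λ y∈B → proj₁ (polar-reflects B (trace A)
              (λ x∈ → proj₂ (equal-dim-⊇ {X} {proj₁ (polar (trace A))} proj₁ X-dim polarA-dim x∈)) y∈B)
            X⊆ : ⟪ X ⟫ ⊆ twisted A ∩ ⟪ polar B ⟫ₕ
            X⊆ (x∈ , x∈′) = inj₁ x∈ , x∈′
            ⊆X : twisted A ∩ ⟪ polar B ⟫ₕ ⊆ ⟪ X ⟫
            ⊆X (inj₁ x∈ , x∈′)       = x∈ , x∈′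
            ⊆X (inj₂ (_ , x∉H) , x∈) = ⊥-elim (x∉H (proj₂ (polar B) x∈))

          -- Here x + 2(e - 1) = 2e + y, so σ(A) ∩ σ(B) has dimension two more than A ∩ B. By 2 ≤ e,
          -- the truncated e ∸ 2 is the true difference.
          polar-polar : ∀ (A B : SubspaceOf H) → HasDim ⟪ A ⟫ₕ (e ∸ 1) → HasDim ⟪ B ⟫ₕ (e ∸ 1) →
            HasDim (⟪ A ⟫ₕ ∩ ⟪ B ⟫ₕ) (e ∸ 2) ⇔ Meets [ ⟪ polar A ⟫ₕ ] [ ⟪ polar B ⟫ₕ ]
          polar-polar A B A-dim B-dim =
            let y , Y-dim = dimension Y
                x , X-dim = dimension X
                x≡y+2 = cancel-2[e-1] (polar-⊓-dims A B A-dim B-dim Y-dim X-dim)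
                X-dim⇔ = HasDim⇔points-size e {[ ⟪ polar A ⟫ₕ ] ∩ [ ⟪ polar B ⟫ₕ ]} X X-dim
                  (∩-size {S₁ = ⟪ polar A ⟫ₕ} {⟪ polar B ⟫ₕ} {⟪ X ⟫} ≐-refl (points-size X X-dim))
            in mk⇔ (λ Y-dim′ → Equivalence.to X-dim⇔ (subst (HasDim ⟪ X ⟫)
                     (≡.trans x≡y+2 (≡.trans (cong (_+ 2) (HasDim-unique Y-dim Y-dim′)) [e-2]+2≡e)) X-dim))
                   (λ meets → subst (HasDim ⟪ Y ⟫)
                     (ℕₚ.+-cancelʳ-≡ 2 y (e ∸ 2) (≡.trans (≡.sym x≡y+2)
                       (≡.trans (HasDim-unique X-dim (Equivalence.from X-dim⇔ meets)) (≡.sym [e-2]+2≡e))))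
                     Y-dim)
            where
            X = proj₁ (polar A) ⊓ proj₁ (polar B)
            Y = proj₁ A ⊓ proj₁ B
            cancel-2[e-1] : ∀ {x y} → x + ((e ∸ 1) + (e ∸ 1)) ≡ h + y → x ≡ y + 2
            cancel-2[e-1] {x} {y} eq = ℕₚ.+-cancelʳ-≡ ((e ∸ 1) + (e ∸ 1)) x (y + 2) (begin
              x + ((e ∸ 1) + (e ∸ 1))         ≡⟨ eq ⟩
              h + y                           ≡⟨ cong (_+ y) e+e≡h ⟨
              e + e + y                       ≡⟨ cong (λ e → e + e + y) [e-1]+1≡e ⟨
              (e ∸ 1 + 1) + (e ∸ 1 + 1) + y   ≡⟨ regroup (e ∸ 1) y ⟩
              y + 2 + ((e ∸ 1) + (e ∸ 1))     ∎)
              where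
              open ≡.≡-Reasoning
              regroup : ∀ a y → (a + 1) + (a + 1) + y ≡ y + 2 + (a + a)
              regroup = ℕ-solver.solve-∀

          isomorphism : twistedGrassmannGraph H e ≅ blockGraph (design H e σ) (pointCount q e)
          isomorphism = record
            { bijection = Bijection⇒Inverse record
              { to        = toBlock
              ; cong      = λ {x} {y} → toBlock-cong x y
              ; bijective = (λ {x} {y} → toBlock-injective x y) ,
                  λ B → let x , x↦B = toBlock-surjective B in
                    x , λ {z} z≈x → ≐-trans (toBlock-cong z x z≈x) x↦B
              }
            ; adjacency = adjacency
            }
            where
            adjacency : ∀ x y → Graph._~_ (twistedGrassmannGraph H e) x y ⇔
              Meets (proj₁ (toBlock x)) (proj₁ (toBlock y))
            adjacency (A , inj₁ A∈𝒜) (B , inj₁ B∈𝒜) = twisted-twisted A B A∈𝒜 B∈𝒜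
            adjacency (A , inj₁ A∈𝒜) (B , inj₂ (B⊆H , _)) = twisted-polar A (B , B⊆H) A∈𝒜
            adjacency (A , inj₂ (A⊆H , _)) (B , inj₁ B∈𝒜) =
              let A⊆B⇔ = twisted-polar B (A , A⊆H) B∈𝒜
                  polarA = [ ⟪ polar (A , A⊆H) ⟫ₕ ]
              in mk⇔ (Meets-sym {[ twisted B ]} {polarA} ∘ Equivalence.to A⊆B⇔)
                     (Equivalence.from A⊆B⇔ ∘ Meets-sym {polarA} {[ twisted B ]})
            adjacency (A , inj₂ (A⊆H , A-dim)) (B , inj₂ (B⊆H , B-dim)) =
              polar-polar (A , A⊆H) (B , B⊆H) A-dim B-dim

theorem1 : ∀ {c ℓ₁ ℓ₂ m ℓm : Level} (q e : ℕ) (q-primePower : IsPrimePower q) → 2 ≤ e →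
    (F : HeytingField c ℓ₁ ℓ₂) → HasSize (HeytingField.setoid F) q →
    (V : Module (scalars F) m ℓm) → let open VectorSpace F V in
    HasDim U (2 * e + 1) →
    (H : Subspace) → HasDim ⟪ H ⟫ (2 * e) →
    (σ : Polarity H) →
    twistedGrassmannGraph H e ≅
    blockGraph (design H e σ) (((q ^ e ∸ 1) / (q ∸ 1)) {{primePower⇒q∸1-nonZero q-primePower}})
theorem1 q e q-primePower 2≤e F F-size V V-dim H H-dim σ =
  -- The isomorphism is built for intersections of size `pointCount q e`, whose closed form is the
  -- required quotient.
  subst (λ N → twistedGrassmannGraph H e ≅ blockGraph (design H e σ) N)
    (≡.sym (pointCount-quotient 1<q e)) isomorphism
  where
  instance
    q∸1-nonZero : NonZero (q ∸ 1)
    q∸1-nonZero = primePower⇒q∸1-nonZero q-primePower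
  1<q : 1 < q
  1<q = ℕₚ.m∸n≢0⇒n<m (≢-nonZero⁻¹ (q ∸ 1))
  open VectorSpace F V
  open FiniteVectorSpace 1<q F F-size V
  open FiniteDimensional V-dim
  open Polar H H-dim σ
  open Hyperplane (ℕₚ.+-comm (2 * e) 1)
  open Isomorphism 2≤e refl
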